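{- Let $r\ge 1$, let $G$ be a regular subgroup of $\mathrm{GA}(r,2)$ and let $\tau: F^r\to F^r$ be the permutation induced by an automorphism of the group $G$. Then the code $S_{\mathcal H,\tau}=\bigcup_{a\in F^r}\mathcal H_a\times\mathcal H_{\tau(a)}$ is a propelinear extended perfect binary code of length $2^{r+1}$.
   Context: $F=\mathrm{GF}(2)$; $F^n$ is the $n$-dimensional vector space over $F$ with the Hamming metric; a code of length $n$ is a set of vectors of $F^n$, whose elements are called codewords. $\mathrm{wt}$ is Hamming weight. ${\bf 0}$ denotes the all-zero vector. A code $C\subseteq F^n$ is perfect if for every $x\in F^n$ there is exactly one $y\in C$ at Hamming distance at most $1$ from $x$. An extended perfect code is a code of length $n+1$ obtained from a perfect code of length $n$ by adding an overall parity check coordinate to all codewords (the position of the parity coordinate is immaterial). $\mathrm{Aut}(F^n)$ is the group of all transformations $(x,\pi)$, $x\in F^n$, $\pi$ a permutation of the coordinate positions, acting by $(x,\pi)(y)=x+\pi(y)$ where $\pi(y)=(y_{\pi^{ -1}(1)},\ldots,y_{\pi^{ -1}(n)})$. $\mathrm{Aut}(C)$ is the setwise stabilizer of $C$ in $\mathrm{Aut}(F^n)$. A group acting on a set is regular if it acts transitively and its order equals the size of the set. A code $C$ is propelinear if $\mathrm{Aut}(C)$ has a subgroup acting regularly on the codewords of $C$. The coordinates of $F^{2^r}$ are indexed by the vectors of $F^r$; $e_a$ is the vector whose only nonzero coordinate is the one indexed by $a$. $\mathcal H=\{c\in F^{2^r}:\sum_{a:c_a=1}a={\bf 0},\ \mathrm{wt}(c)\equiv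 0 \pmod 2\}$ (an extended Hamming code), and $\mathcal H_a=\mathcal H+e_a+e_{\bf 0}$ for $a\in F^r$. For codes $C,D$, $C\times D=\{x|y: x\in C,\ y\in D\}$, where $x|y$ is concatenation. $\mathrm{GA}(r,2)=\{(a,M):a\in F^r,\ M\in\mathrm{GL}(r,2)\}$ is the general affine group, acting on $F^r$ by $(a,M)(b)=a+Mb$, with composition as group operation. A subgroup $G$ of $\mathrm{GA}(r,2)$ is regular if it acts regularly on the vectors of $F^r$. For such $G$ and $a\in F^r$, $g_a$ denotes the unique element of $G$ mapping ${\bf 0}$ to $a$. The permutation $\tau$ of $F^r$ induced by an automorphism $T$ of the group $G$ is defined by $T(g_a)=g_{\tau(a)}$ for all $a\in F^r$. -}

module Defs where

open import Algebra.Bundles using (Group)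
open import Algebra.Morphism.Structures using (IsGroupIsomorphism)
open import Data.Bool using (Bool; true; false; _∧_; _xor_)
open import Data.Bool.Properties
  using (T?; xor-assoc; xor-comm; xor-identityˡ; xor-identityʳ; xor-same;
         ∧-distribʳ-xor; ∧-zeroʳ)
open import Data.Fin using (Fin; zero; suc)
open import Data.Fin.Permutation as Perm
  using (Permutation′; _⟨$⟩ʳ_; _⟨$⟩ˡ_; _∘ₚ_)
open import Data.Fin.Properties using (2↔Bool; *↔×)
open import Data.Nat using (ℕ; zero; suc; _+_; _^_; _≤_)
open import Data.Nat.Divisibility using (_∣_)
open import Data.Nat.Properties using (+-identityʳ)
open import Data.Product using (Σ; ∃; ∃!; _×_; _,_; proj₁; proj₂; uncurry)
open import Data.Product.Function.NonDependent.Propositional using (_×-↔_)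
open import Data.Vec
  using (Vec; []; _∷_; _++_; map; zipWith; replicate; lookup; tabulate;
         foldr′; count; insertAt; _[_]≔_)
open import Data.Vec.Properties
  using (zipWith-assoc; zipWith-comm; zipWith-identityˡ; zipWith-identityʳ;
         map-cong; map-id; map-∘; lookup∘tabulate;
         tabulate∘lookup; tabulate-cong; lookup-zipWith; tabulate-∘)
open import Function using (_∘_; _↔_; Inverse; mk↔ₛ′)
open import Function.Construct.Composition using (_↔-∘_)
open import Level using (Level; 0ℓ; _⊔_) renaming (suc to lsuc)
open import Relation.Binary.Bundles using (Setoid)
open import Relation.Binary.Definitions using (_Respects_)
open import Relation.Binary.PropositionalEquality as ≡
  using (_≡_; refl; sym; trans; cong; cong₂; subst; module ≡-Reasoning)
import Relation.Binary.Construct.On as On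
open import Relation.Unary using (Pred; _∈_; _⊆_; _≐_; ⋃; U)

private variable
  a c ℓ p : Level
  A : Set a
  m n r : ℕ

-- GF(2) is Bool: false is 0, true is 1, _xor_ is + and _∧_ is ·.
F : ℕ → Set
F n = Vec Bool n

infixl 6 _⊕_
infixr 7 _·_

𝟎 : F n
𝟎 = replicate _ false

_⊕_ : F n → F n → F n
_⊕_ = zipWith _xor_

_·_ : Bool → F n → F n
b · x = map (b ∧_) x

∑ : Vec (F n) m → F n
∑ = foldr′ _⊕_ 𝟎

wt : F n → ℕ
wt = count T?

dist : F n → F n → ℕ
dist x y = wt (x ⊕ y)

unit : Fin n → F n
unit i = 𝟎 [ i ]≔ true

⊕-assoc : (x y z : F n) → (x ⊕ y) ⊕ z ≡ x ⊕ (y ⊕ z)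
⊕-assoc = zipWith-assoc xor-assoc

⊕-comm : (x y : F n) → x ⊕ y ≡ y ⊕ x
⊕-comm = zipWith-comm xor-comm

⊕-identityˡ : (x : F n) → 𝟎 ⊕ x ≡ x
⊕-identityˡ = zipWith-identityˡ xor-identityˡ

⊕-identityʳ : (x : F n) → x ⊕ 𝟎 ≡ x
⊕-identityʳ = zipWith-identityʳ xor-identityʳ

⊕-self : (x : F n) → x ⊕ x ≡ 𝟎
⊕-self []      = refl
⊕-self (b ∷ x) = cong₂ _∷_ (xor-same b) (⊕-self x)

⊕-interchange : (w x y z : F n) → (w ⊕ x) ⊕ (y ⊕ z) ≡ (w ⊕ y) ⊕ (x ⊕ z)
⊕-interchange w x y z = begin
  (w ⊕ x) ⊕ (y ⊕ z) ≡⟨ ⊕-assoc w x (y ⊕ z) ⟩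
  w ⊕ (x ⊕ (y ⊕ z)) ≡⟨ cong (w ⊕_) (⊕-assoc x y z) ⟨
  w ⊕ ((x ⊕ y) ⊕ z) ≡⟨ cong (λ s → w ⊕ (s ⊕ z)) (⊕-comm x y) ⟩
  w ⊕ ((y ⊕ x) ⊕ z) ≡⟨ cong (w ⊕_) (⊕-assoc y x z) ⟩
  w ⊕ (y ⊕ (x ⊕ z)) ≡⟨ ⊕-assoc w y (x ⊕ z) ⟨
  (w ⊕ y) ⊕ (x ⊕ z) ∎
  where open ≡-Reasoning

·-false : (x : F n) → false · x ≡ 𝟎
·-false []      = refl
·-false (b ∷ x) = cong (false ∷_) (·-false x)

·-true : (x : F n) → true · x ≡ x
·-true = map-id

·-xor : (a b : Bool) (x : F n) → (a xor b) · x ≡ a · x ⊕ b · x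
·-xor a b []      = refl
·-xor a b (c ∷ x) = cong₂ _∷_ (∧-distribʳ-xor c a b) (·-xor a b x)

record Subgroup (G : Group c ℓ) (p : Level) : Set (c ⊔ ℓ ⊔ lsuc p) where
  open Group G
  field
    Mem       : Pred Carrier p
    resp      : Mem Respects _≈_
    ∙-closed  : ∀ {x y} → x ∈ Mem → y ∈ Mem → x ∙ y ∈ Mem
    ε-closed  : ε ∈ Mem
    ⁻¹-closed : ∀ {x} → x ∈ Mem → x ⁻¹ ∈ Mem

  group : Group (c ⊔ p) ℓ
  group = record
    { Carrier = Σ Carrier Mem
    ; _≈_     = λ x y → proj₁ x ≈ proj₁ y
    ; _∙_     = λ (x , x∈) (y , y∈) → x ∙ y , ∙-closed x∈ y∈
    ; ε       = ε , ε-closed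
    ; _⁻¹     = λ (x , x∈) → x ⁻¹ , ⁻¹-closed x∈
    ; isGroup = record
      { isMonoid = record
        { isSemigroup = record
          { isMagma = record
            { isEquivalence = On.isEquivalence proj₁ isEquivalence
            ; ∙-cong        = ∙-cong
            }
          ; assoc = λ x y z → assoc (proj₁ x) (proj₁ y) (proj₁ z)
          }
        ; identity = (λ x → identityˡ (proj₁ x)) , (λ x → identityʳ (proj₁ x))
        }
      ; inverse = (λ x → inverseˡ (proj₁ x)) , (λ x → inverseʳ (proj₁ x))
      ; ⁻¹-cong = ⁻¹-cong
      }
    }

-- Membership proofs are ignored: two elements of a subset are equal when the
-- underlying elements are.
SubsetSetoid : {A : Set a} → Pred A p → Setoid (a ⊔ p) a
SubsetSetoid {A = A} X = On.setoid {B = Σ A X} (≡.setoid A) proj₁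

HasSize : Setoid c ℓ → ℕ → Set (c ⊔ ℓ)
HasSize S n = Inverse S (≡.setoid (Fin n))

record IsRegularOn {A : Set} {G : Group 0ℓ 0ℓ} (H : Subgroup G 0ℓ)
                   (_▷_ : Group.Carrier G → A → A) (X : Pred A 0ℓ) : Set where
  field
    transitive : ∀ {x y} → x ∈ X → y ∈ X →
                 ∃ λ (h : Group.Carrier (Subgroup.group H)) → proj₁ h ▷ x ≡ y
    order≡size : ∃ λ n → HasSize (Group.setoid (Subgroup.group H)) n
                       × HasSize (SubsetSetoid X) n

-- Aut(F^n) and GA(r,2) both consist of the transformations y ↦ x + q(y) with
-- x ∈ F^n and q in a group acting additively on F^n (coordinate permutations,
-- respectively invertible matrices), so their group laws are proved together.
record AdditiveAction (n : ℕ) : Set₁ where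
  infixr 8 _⋆_
  field
    group : Group 0ℓ 0ℓ
  open Group group using (Carrier; _≈_; _∙_; ε; _⁻¹) public
  field
    _⋆_    : Carrier → F n → F n
    ⋆-cong : ∀ {q s} → q ≈ s → ∀ y → q ⋆ y ≡ s ⋆ y
    ⋆-ε    : ∀ y → ε ⋆ y ≡ y
    ⋆-∙    : ∀ q s y → (q ∙ s) ⋆ y ≡ q ⋆ (s ⋆ y)
    ⋆-⊕    : ∀ q x y → q ⋆ (x ⊕ y) ≡ q ⋆ x ⊕ q ⋆ y

module Affine (Q : AdditiveAction n) where
  open AdditiveAction Q hiding (group)
  private module Q = Group (AdditiveAction.group Q)

  infixr 5 _▷_

  _▷_ : F n × Carrier → F n → F n
  (x , q) ▷ y = x ⊕ q ⋆ y

  _∘ᴬ_ : F n × Carrier → F n × Carrier → F n × Carrier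
  (x , q) ∘ᴬ (y , s) = x ⊕ q ⋆ y , q ∙ s

  ▷-∘ᴬ : ∀ g h y → (g ∘ᴬ h) ▷ y ≡ g ▷ h ▷ y
  ▷-∘ᴬ (x , q) (y , s) z = begin
    (x ⊕ q ⋆ y) ⊕ (q ∙ s) ⋆ z   ≡⟨ cong (x ⊕ q ⋆ y ⊕_) (⋆-∙ q s z) ⟩
    (x ⊕ q ⋆ y) ⊕ q ⋆ (s ⋆ z)   ≡⟨ ⊕-assoc x (q ⋆ y) (q ⋆ (s ⋆ z)) ⟩
    x ⊕ (q ⋆ y ⊕ q ⋆ (s ⋆ z))   ≡⟨ cong (x ⊕_) (⋆-⊕ q y (s ⋆ z)) ⟨
    x ⊕ q ⋆ (y ⊕ s ⋆ z)         ∎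
    where open ≡-Reasoning

  ⋆-𝟎 : ∀ q → q ⋆ 𝟎 ≡ 𝟎
  ⋆-𝟎 q = begin
    q ⋆ 𝟎          ≡⟨ cong (q ⋆_) (⊕-self 𝟎) ⟨
    q ⋆ (𝟎 ⊕ 𝟎)    ≡⟨ ⋆-⊕ q 𝟎 𝟎 ⟩
    q ⋆ 𝟎 ⊕ q ⋆ 𝟎  ≡⟨ ⊕-self (q ⋆ 𝟎) ⟩
    𝟎              ∎
    where open ≡-Reasoning

  affineGroup : Group 0ℓ 0ℓ
  affineGroup = record
    { Carrier = F n × Carrier
    ; _≈_     = λ (x , q) (y , s) → x ≡ y × q ≈ s
    ; _∙_     = _∘ᴬ_
    ; ε       = 𝟎 , ε
    ; _⁻¹     = λ (x , q) → (q ⁻¹) ⋆ x , q ⁻¹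
    ; isGroup = record
      { isMonoid = record
        { isSemigroup = record
          { isMagma = record
            { isEquivalence = record
              { refl  = refl , Q.refl
              ; sym   = λ (e , f) → sym e , Q.sym f
              ; trans = λ (e , f) (e′ , f′) → trans e e′ , Q.trans f f′
              }
            ; ∙-cong = λ {g} {g′} {h} {h′} (e , f) (e′ , f′) →
                cong₂ _⊕_ e (trans (⋆-cong f (proj₁ h)) (cong (proj₂ g′ ⋆_) e′)) ,
                Q.∙-cong f f′
            }
          ; assoc = λ g h k → ▷-∘ᴬ g h (proj₁ k) ,
                              Q.assoc (proj₂ g) (proj₂ h) (proj₂ k)
          }
        ; identity =
            (λ (x , q) → trans (⊕-identityˡ (ε ⋆ x)) (⋆-ε x) , Q.identityˡ q) ,
            (λ (x , q) → trans (cong (x ⊕_) (⋆-𝟎 q)) (⊕-identityʳ x) ,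
                         Q.identityʳ q)
        }
      ; inverse =
          (λ (x , q) → ⊕-self ((q ⁻¹) ⋆ x) , Q.inverseˡ q) ,
          (λ (x , q) →
             trans (cong (x ⊕_) (trans (sym (⋆-∙ q (q ⁻¹) x))
                                (trans (⋆-cong (Q.inverseʳ q) x) (⋆-ε x))))
                   (⊕-self x) ,
             Q.inverseʳ q)
      ; ⁻¹-cong = λ {g} {h} (e , f) →
          trans (⋆-cong (Q.⁻¹-cong f) (proj₁ g)) (cong ((proj₂ h ⁻¹) ⋆_) e) ,
          Q.⁻¹-cong f
      }
    }

permute : Permutation′ n → F n → F n
permute π y = tabulate λ i → lookup y (π ⟨$⟩ˡ i)

⟨$⟩ˡ-cong : {π ρ : Permutation′ n} → π Perm.≈ ρ → ∀ i → π ⟨$⟩ˡ i ≡ ρ ⟨$⟩ˡ i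
⟨$⟩ˡ-cong {π = π} {ρ} π≈ρ i = begin
  π ⟨$⟩ˡ i                      ≡⟨ cong (π ⟨$⟩ˡ_) (Perm.inverseʳ ρ) ⟨
  π ⟨$⟩ˡ (ρ ⟨$⟩ʳ (ρ ⟨$⟩ˡ i))    ≡⟨ cong (π ⟨$⟩ˡ_) (π≈ρ (ρ ⟨$⟩ˡ i)) ⟨
  π ⟨$⟩ˡ (π ⟨$⟩ʳ (ρ ⟨$⟩ˡ i))    ≡⟨ Perm.inverseˡ π ⟩
  ρ ⟨$⟩ˡ i                      ∎
  where open ≡-Reasoning

-- _∘ₚ_ composes diagrammatically, hence the reversed arguments.
permutationGroup : ℕ → Group 0ℓ 0ℓ
permutationGroup n = record
  { Carrier = Permutation′ n
  ; _≈_     = Perm._≈_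
  ; _∙_     = λ π ρ → ρ ∘ₚ π
  ; ε       = Perm.id
  ; _⁻¹     = Perm.flip
  ; isGroup = record
    { isMonoid = record
      { isSemigroup = record
        { isMagma = record
          { isEquivalence = record
            { refl  = λ _ → refl
            ; sym   = λ e i → sym (e i)
            ; trans = λ e f i → trans (e i) (f i)
            }
          ; ∙-cong = λ {π} {π′} {ρ} {ρ′} e f i →
              trans (e (ρ ⟨$⟩ʳ i)) (cong (π′ ⟨$⟩ʳ_) (f i))
          }
        ; assoc = λ _ _ _ _ → refl
        }
      ; identity = (λ _ _ → refl) , (λ _ _ → refl)
      }
    ; inverse = (λ π _ → Perm.inverseˡ π) , (λ π _ → Perm.inverseʳ π)
    ; ⁻¹-cong = λ {π} {ρ} → ⟨$⟩ˡ-cong {π = π} {ρ}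
    }
  }

permutationAction : (n : ℕ) → AdditiveAction n
permutationAction n = record
  { group  = permutationGroup n
  ; _⋆_    = permute
  ; ⋆-cong = λ {π} {ρ} π≈ρ y →
      tabulate-cong λ i → cong (lookup y) (⟨$⟩ˡ-cong {π = π} {ρ} π≈ρ i)
  ; ⋆-ε    = tabulate∘lookup
  ; ⋆-∙    = λ π ρ y → tabulate-cong λ i → sym (lookup∘tabulate _ (π ⟨$⟩ˡ i))
  ; ⋆-⊕    = λ π x y → trans
      (tabulate-cong λ i → lookup-zipWith _xor_ (π ⟨$⟩ˡ i) x y)
      (tabulate-zipWith (λ i → lookup x (π ⟨$⟩ˡ i)) (λ i → lookup y (π ⟨$⟩ˡ i)))
  }
  where
  tabulate-zipWith : ∀ {k} (f g : Fin k → Bool) →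
    tabulate (λ i → f i xor g i) ≡ tabulate f ⊕ tabulate g
  tabulate-zipWith {zero}  f g = refl
  tabulate-zipWith {suc k} f g =
    cong₂ _∷_ refl (tabulate-zipWith (f ∘ suc) (g ∘ suc))

module AutF (n : ℕ) = Affine (permutationAction n)

AutF : ℕ → Group 0ℓ 0ℓ
AutF n = AutF.affineGroup n

-- A matrix is the vector of its columns.
Matrix : ℕ → ℕ → Set
Matrix m n = Vec (F m) n

infixr 8 _*ᵥ_
infixl 7 _*ᵐ_

_*ᵥ_ : Matrix m n → F n → F m
M *ᵥ b = ∑ (zipWith _·_ b M)

_*ᵐ_ : Matrix m n → Matrix n r → Matrix m r
M *ᵐ N = map (M *ᵥ_) N

1ᵐ : Matrix n n
1ᵐ = tabulate unit

*ᵥ-⊕ : (M : Matrix m n) (x y : F n) → M *ᵥ (x ⊕ y) ≡ M *ᵥ x ⊕ M *ᵥ y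
*ᵥ-⊕ []      []      []      = sym (⊕-self 𝟎)
*ᵥ-⊕ (v ∷ M) (a ∷ x) (b ∷ y) = trans
  (cong₂ _⊕_ (·-xor a b v) (*ᵥ-⊕ M x y))
  (⊕-interchange (a · v) (b · v) (M *ᵥ x) (M *ᵥ y))

*ᵥ-𝟎 : (M : Matrix m n) → M *ᵥ 𝟎 ≡ 𝟎
*ᵥ-𝟎 M = begin
  M *ᵥ 𝟎            ≡⟨ cong (M *ᵥ_) (⊕-self 𝟎) ⟨
  M *ᵥ (𝟎 ⊕ 𝟎)      ≡⟨ *ᵥ-⊕ M 𝟎 𝟎 ⟩
  M *ᵥ 𝟎 ⊕ M *ᵥ 𝟎   ≡⟨ ⊕-self (M *ᵥ 𝟎) ⟩
  𝟎                 ∎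
  where open ≡-Reasoning

*ᵥ-· : (M : Matrix m n) (b : Bool) (x : F n) → M *ᵥ (b · x) ≡ b · (M *ᵥ x)
*ᵥ-· M false x = trans (cong (M *ᵥ_) (·-false x))
                       (trans (*ᵥ-𝟎 M) (sym (·-false (M *ᵥ x))))
*ᵥ-· M true  x = trans (cong (M *ᵥ_) (·-true x)) (sym (·-true (M *ᵥ x)))

*ᵐ-*ᵥ : (M : Matrix m n) (N : Matrix n r) (x : F r) →
        (M *ᵐ N) *ᵥ x ≡ M *ᵥ (N *ᵥ x)
*ᵐ-*ᵥ M []      []      = sym (*ᵥ-𝟎 M)
*ᵐ-*ᵥ M (v ∷ N) (b ∷ x) = trans
  (cong₂ _⊕_ (sym (*ᵥ-· M b v)) (*ᵐ-*ᵥ M N x))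
  (sym (*ᵥ-⊕ M (b · v) (N *ᵥ x)))

*ᵐ-assoc : ∀ {s} (M : Matrix m n) (N : Matrix n r) (P : Matrix r s) →
           (M *ᵐ N) *ᵐ P ≡ M *ᵐ (N *ᵐ P)
*ᵐ-assoc M N P = trans (map-cong (*ᵐ-*ᵥ M N) P) (map-∘ (M *ᵥ_) (N *ᵥ_) P)

1ᵐ-*ᵥ : (x : F n) → 1ᵐ *ᵥ x ≡ x
1ᵐ-*ᵥ []      = refl
1ᵐ-*ᵥ (b ∷ x) = begin
  b · (true ∷ 𝟎) ⊕ tabulate (unit ∘ suc) *ᵥ x  ≡⟨ cong₂ _⊕_ (head b) (tail unit x) ⟩
  (b ∷ 𝟎) ⊕ (false ∷ 1ᵐ *ᵥ x)                   ≡⟨ cong₂ _∷_ (xor-identityʳ b) (⊕-identityˡ (1ᵐ *ᵥ x)) ⟩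
  b ∷ 1ᵐ *ᵥ x                                   ≡⟨ cong (b ∷_) (1ᵐ-*ᵥ x) ⟩
  b ∷ x                                         ∎
  where
  open ≡-Reasoning
  head : ∀ {k} b → b · (true ∷ 𝟎 {k}) ≡ b ∷ 𝟎
  head false = cong (false ∷_) (·-false 𝟎)
  head true  = cong (true ∷_) (·-true 𝟎)

  tail : ∀ {j k} (f : Fin j → F k) (y : F j) →
         tabulate (λ i → false ∷ f i) *ᵥ y ≡ false ∷ (tabulate f *ᵥ y)
  tail f []      = refl
  tail f (c ∷ y) = trans (cong (c · (false ∷ f zero) ⊕_) (tail (f ∘ suc) y))
                         (cong₂ _∷_ (trans (xor-identityʳ (c ∧ false)) (∧-zeroʳ c)) refl)

*ᵥ-unit : (M : Matrix m n) (i : Fin n) → M *ᵥ unit i ≡ lookup M i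
*ᵥ-unit (v ∷ M) zero    = trans (cong₂ _⊕_ (·-true v) (*ᵥ-𝟎 M)) (⊕-identityʳ v)
*ᵥ-unit (v ∷ M) (suc i) = trans (cong₂ _⊕_ (·-false v) (*ᵥ-unit M i))
                                (⊕-identityˡ (lookup M i))

*ᵐ-identityˡ : (M : Matrix m n) → 1ᵐ *ᵐ M ≡ M
*ᵐ-identityˡ M = trans (map-cong 1ᵐ-*ᵥ M) (map-id M)

*ᵐ-identityʳ : (M : Matrix m n) → M *ᵐ 1ᵐ ≡ M
*ᵐ-identityʳ M = trans (sym (tabulate-∘ (M *ᵥ_) unit))
                       (trans (tabulate-cong (*ᵥ-unit M)) (tabulate∘lookup M))

record GLMatrix (r : ℕ) : Set where
  field
    mat   : Matrix r r
    mat⁻¹ : Matrix r r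
    invˡ  : mat⁻¹ *ᵐ mat ≡ 1ᵐ
    invʳ  : mat *ᵐ mat⁻¹ ≡ 1ᵐ

open GLMatrix

private
  *ᵐ-cancel-middle : (A B C D : Matrix r r) → B *ᵐ C ≡ 1ᵐ → A *ᵐ D ≡ 1ᵐ →
                     (A *ᵐ B) *ᵐ (C *ᵐ D) ≡ 1ᵐ
  *ᵐ-cancel-middle A B C D BC AD = begin
    (A *ᵐ B) *ᵐ (C *ᵐ D) ≡⟨ *ᵐ-assoc A B (C *ᵐ D) ⟩
    A *ᵐ (B *ᵐ (C *ᵐ D)) ≡⟨ cong (A *ᵐ_) (*ᵐ-assoc B C D) ⟨
    A *ᵐ ((B *ᵐ C) *ᵐ D) ≡⟨ cong (λ E → A *ᵐ (E *ᵐ D)) BC ⟩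
    A *ᵐ (1ᵐ *ᵐ D)       ≡⟨ cong (A *ᵐ_) (*ᵐ-identityˡ D) ⟩
    A *ᵐ D               ≡⟨ AD ⟩
    1ᵐ                   ∎
    where open ≡-Reasoning

mat⁻¹-unique : (M N : GLMatrix r) → mat M ≡ mat N → mat⁻¹ M ≡ mat⁻¹ N
mat⁻¹-unique M N e = begin
  mat⁻¹ M                       ≡⟨ *ᵐ-identityʳ (mat⁻¹ M) ⟨
  mat⁻¹ M *ᵐ 1ᵐ                 ≡⟨ cong (mat⁻¹ M *ᵐ_) (invʳ N) ⟨
  mat⁻¹ M *ᵐ (mat N *ᵐ mat⁻¹ N) ≡⟨ *ᵐ-assoc (mat⁻¹ M) (mat N) (mat⁻¹ N) ⟨
  (mat⁻¹ M *ᵐ mat N) *ᵐ mat⁻¹ N ≡⟨ cong (λ E → (mat⁻¹ M *ᵐ E) *ᵐ mat⁻¹ N) e ⟨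
  (mat⁻¹ M *ᵐ mat M) *ᵐ mat⁻¹ N ≡⟨ cong (_*ᵐ mat⁻¹ N) (invˡ M) ⟩
  1ᵐ *ᵐ mat⁻¹ N                 ≡⟨ *ᵐ-identityˡ (mat⁻¹ N) ⟩
  mat⁻¹ N                       ∎
  where open ≡-Reasoning

GL : ℕ → Group 0ℓ 0ℓ
GL r = record
  { Carrier = GLMatrix r
  ; _≈_     = λ M N → mat M ≡ mat N
  ; _∙_     = λ M N → record
      { mat   = mat M *ᵐ mat N
      ; mat⁻¹ = mat⁻¹ N *ᵐ mat⁻¹ M
      ; invˡ  = *ᵐ-cancel-middle (mat⁻¹ N) (mat⁻¹ M) (mat M) (mat N) (invˡ M) (invˡ N)
      ; invʳ  = *ᵐ-cancel-middle (mat M) (mat N) (mat⁻¹ N) (mat⁻¹ M) (invʳ N) (invʳ M)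
      }
  ; ε       = record { mat = 1ᵐ ; mat⁻¹ = 1ᵐ
                     ; invˡ = *ᵐ-identityˡ 1ᵐ ; invʳ = *ᵐ-identityˡ 1ᵐ }
  ; _⁻¹     = λ M → record { mat = mat⁻¹ M ; mat⁻¹ = mat M
                           ; invˡ = invʳ M ; invʳ = invˡ M }
  ; isGroup = record
    { isMonoid = record
      { isSemigroup = record
        { isMagma = record
          { isEquivalence = record { refl = refl ; sym = sym ; trans = trans }
          ; ∙-cong        = cong₂ _*ᵐ_
          }
        ; assoc = λ M N P → *ᵐ-assoc (mat M) (mat N) (mat P)
        }
      ; identity = (λ M → *ᵐ-identityˡ (mat M)) , (λ M → *ᵐ-identityʳ (mat M))
      }
    ; inverse = invˡ , invʳ
    ; ⁻¹-cong = λ {M} {N} → mat⁻¹-unique M N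
    }
  }

linearAction : (r : ℕ) → AdditiveAction r
linearAction r = record
  { group  = GL r
  ; _⋆_    = λ M y → mat M *ᵥ y
  ; ⋆-cong = λ e y → cong (_*ᵥ y) e
  ; ⋆-ε    = 1ᵐ-*ᵥ
  ; ⋆-∙    = λ M N → *ᵐ-*ᵥ (mat M) (mat N)
  ; ⋆-⊕    = λ M → *ᵥ-⊕ (mat M)
  }

module GA (r : ℕ) = Affine (linearAction r)

GA : ℕ → Group 0ℓ 0ℓ
GA r = GA.affineGroup r

IsRegularSubgroup : Subgroup (GA r) 0ℓ → Set
IsRegularSubgroup {r} G = IsRegularOn G (GA._▷_ r) U

module RegularSubgroup {r : ℕ} (G : Subgroup (GA r) 0ℓ)
                       (regular : IsRegularSubgroup G) where
  open Group (Subgroup.group G) using (Carrier; _≈_; rawGroup) public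
  open IsRegularOn regular

  -- Since G is transitive and ∣G∣ = ∣F^r∣, the element of G mapping 𝟎 to a is
  -- unique up to _≈_, so it does not matter which one transitivity returns.
  g[_] : F r → Carrier
  g[ a ] = proj₁ (transitive {𝟎} {a} _ _)

  IsAutomorphism : (Carrier → Carrier) → Set
  IsAutomorphism = IsGroupIsomorphism rawGroup rawGroup

  Induces : (Carrier → Carrier) → (F r → F r) → Set
  Induces T τ = ∀ a → T g[ a ] ≈ g[ τ a ]

Code : ℕ → Set₁
Code n = Pred (F n) 0ℓ

image : (F m → F n) → Code m → Code n
image f C y = ∃ λ x → x ∈ C × y ≡ f x

IsPerfect : Code n → Set
IsPerfect {n} C = ∀ (x : F n) → ∃! _≡_ λ y → y ∈ C × dist x y ≤ 1

addParity : Fin (suc n) → F n → F (suc n)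
addParity i x = insertAt x i (foldr′ _xor_ false x)

data IsExtendedPerfect : ∀ {m} → Code m → Set₁ where
  extended : (D : Code n) → IsPerfect D → (i : Fin (suc n)) →
             {C : Code (suc n)} → C ≐ image (addParity i) D →
             IsExtendedPerfect C

Aut : Code n → Pred (Group.Carrier (AutF n)) 0ℓ
Aut {n} C g = image (AutF._▷_ n g) C ≐ C

IsPropelinear : Code n → Set₁
IsPropelinear {n} C = ∃ λ (H : Subgroup (AutF n) 0ℓ) →
  Subgroup.Mem H ⊆ Aut C × IsRegularOn H (AutF._▷_ n) C

_×ᶜ_ : Code m → Code n → Code (m + n)
(C ×ᶜ D) z = ∃ λ x → ∃ λ y → x ∈ C × y ∈ D × z ≡ x ++ y

_+ᶜ_ : Code n → F n → Code n
C +ᶜ v = image (_⊕ v) C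

-- A numbering of the vectors of F^r, used to index the coordinates of
-- F^(2^r) by them.
vector : (r : ℕ) → Fin (2 ^ r) ↔ F r
vector zero    = mk↔ₛ′ (λ _ → []) (λ _ → zero) (λ { [] → refl }) (λ { zero → refl })
vector (suc r) =
  mk↔ₛ′ (uncurry _∷_) (λ { (b ∷ x) → b , x }) (λ { (_ ∷ _) → refl }) (λ _ → refl)
  ↔-∘ ((2↔Bool ×-↔ vector r) ↔-∘ *↔×)

e[_] : F r → F (2 ^ r)
e[ a ] = unit (Inverse.from (vector _) a)

-- The sum of the a with c_a = 1, written as the sum of all c_a · a.
∑supp : F (2 ^ r) → F r
∑supp {r} c = ∑ (tabulate λ i → lookup c i · Inverse.to (vector r) i)

ℋ : (r : ℕ) → Code (2 ^ r)
ℋ r c = ∑supp {r} c ≡ 𝟎 × 2 ∣ wt c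

ℋ[_] : F r → Code (2 ^ r)
ℋ[_] {r} a = (ℋ r +ᶜ e[ a ]) +ᶜ e[ 𝟎 {r} ]

-- The union has length 2^r + 2^r, which 2 ^ suc r only equals propositionally.
S : (F r → F r) → Code (2 ^ suc r)
S {r} τ = subst Code (cong (2 ^ r +_) (sym (+-identityʳ (2 ^ r))))
  (⋃[ a ∶ F r ] (ℋ[ a ] ×ᶜ ℋ[ τ a ]))

-- Write γ a for the element of G mapping 𝟎 to a. Since ℋ[ a ] consists of the
-- even vectors with syndrome a, the code S τ is the set of x|y with x and y even
-- and τ (∑supp x) = ∑supp y. A vector of odd weight has exactly one odd half, and
-- as τ is bijective exactly one flip in that half repairs it: S τ is extended
-- perfect. For u|v in S τ let γ (∑supp u) and γ (∑supp v) permute the coordinates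
-- of the two halves; followed by the translation by u|v this acts on the syndromes
-- as (γ (∑supp u), γ (∑supp v)), because even vectors do not see the translation
-- part of an affine coordinate permutation. It preserves S τ because T is a
-- homomorphism, and γ (γ a ▷ b) = γ a ∙ γ b makes these transformations a group,
-- one for each codeword.
module Submission where

open import Defs
open import Algebra.Bundles using (Group)
import Algebra.Properties.Group as GroupProperties
open import Algebra.Morphism.Structures using (IsGroupIsomorphism)
open import Data.Bool using (Bool; true; false; not; if_then_else_; _xor_)
open import Data.Bool.Properties as Bool
  using (not-involutive; xor-assoc; xor-comm; xor-identityʳ)
open import Data.Fin using (Fin; zero; suc; _↑ˡ_; _↑ʳ_; punchOut; splitAt)
open import Data.Fin.Permutation as Perm using (Permutation′; _⟨$⟩ʳ_; _⟨$⟩ˡ_; _∘ₚ_)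
open import Data.Fin.Properties as Fin
  using (+↔⊎; any?; injective⇒≤; punchOut-injective; splitAt-↑ˡ; splitAt-↑ʳ;
         splitAt⁻¹-↑ˡ; splitAt⁻¹-↑ʳ)
open import Data.Nat using (ℕ; zero; suc; _+_; _^_; _≤_; z≤n; s≤s⁻¹)
open import Data.Nat.Divisibility using (_∣_; m%n≡0⇒n∣m; n∣m⇒m%n≡0)
open import Data.Nat.DivMod using (_%_; %-distribˡ-+)
open import Data.Nat.Properties using (1+n≰n; ≤-reflexive; n≤0⇒n≡0; +-identityʳ)
open import Data.Product using (Σ; ∃; _×_; _,_; proj₁; proj₂)
open import Data.Sum using (_⊎_; inj₁; inj₂)
open import Data.Sum.Function.Propositional using (_⊎-↔_)
open import Data.Vec using ([]; _∷_; _++_; foldr′; head; lookup; tabulate; take; drop)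
open import Data.Vec.Properties
  using (≡-dec; drop-zipWith; lookup∘tabulate; lookup∘update; lookup∘update′; tabulate-cong;
         tabulate∘lookup; lookup-++ˡ; lookup-++ʳ; take-zipWith; take++drop≡id; ++-injective)
open import Function using (_∘_; _↔_; Inverse; mk↔ₛ′)
open import Function.Construct.Composition using (_↔-∘_; inverse)
open import Function.Construct.Symmetry using (↔-sym)
open import Function.Definitions using (Injective)
open import Level using (0ℓ)
open import Relation.Binary.Bundles using (Setoid)
open import Relation.Binary.PropositionalEquality as ≡
  using (_≡_; refl; sym; trans; cong; cong₂; subst; subst₂; module ≡-Reasoning)
open import Relation.Nullary using (Dec; yes; no; ¬_; contradiction)
open import Relation.Nullary.Decidable using (_×-dec_; map′)
open import Relation.Unary using (Decidable; _∈_; _⊆_; ⋃; U)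

private variable
  m n : ℕ

-- Counting in finite sets.

-- A missed value `y` could be punched out of the codomain, which would leave an injection from
-- `suc n` elements into `n`.
injective⇒surjective : {f : Fin n → Fin n} → Injective _≡_ _≡_ f → ∀ y → ∃ λ x → f x ≡ y
injective⇒surjective {suc n} {f} inj y with any? (λ x → f x Fin.≟ y)
... | yes hit = hit
... | no miss = contradiction (injective⇒≤ punched) 1+n≰n
  where
  y≢f : ∀ x → ¬ y ≡ f x
  y≢f x e = miss (x , sym e)

  punched : Injective _≡_ _≡_ (λ x → punchOut (y≢f x))
  punched {x} {x′} e = inj (punchOut-injective (y≢f x) (y≢f x′) e)

-- A section of f is injective, hence by counting surjective.
split-epi⇒injective : ∀ {a b ℓ₁ ℓ₂} {A : Setoid a ℓ₁} {B : Setoid b ℓ₂} →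
  let module A = Setoid A; module B = Setoid B in
  HasSize A n → HasSize B n →
  (f : A.Carrier → B.Carrier) → (∀ {x y} → x A.≈ y → f x B.≈ f y) →
  (s : B.Carrier → A.Carrier) → (∀ {x y} → x B.≈ y → s x A.≈ s y) →
  (∀ y → f (s y) B.≈ y) → Injective A._≈_ B._≈_ f
split-epi⇒injective {A = A} {B} IA IB f f-cong s s-cong fs {x} {y} fx≈fy =
  A.trans (A.sym (sf x)) (A.trans (s-cong fx≈fy) (sf y))
  where
  module A = Setoid A
  module B = Setoid B
  module IA = Inverse IA
  module IB = Inverse IB

  s-inj : ∀ {x y} → s x A.≈ s y → x B.≈ y
  s-inj {x} {y} e = B.trans (B.sym (fs x)) (B.trans (f-cong e) (fs y))

  to-inj : ∀ {x y} → IA.to x ≡ IA.to y → x A.≈ y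
  to-inj {x} {y} e =
    A.trans (A.sym (IA.strictlyInverseʳ x)) (A.trans (IA.from-cong e) (IA.strictlyInverseʳ y))

  from-inj : ∀ {i j} → IB.from i B.≈ IB.from j → i ≡ j
  from-inj {i} {j} e =
    trans (sym (IB.strictlyInverseˡ i)) (trans (IB.to-cong e) (IB.strictlyInverseˡ j))

  sf : ∀ x → s (f x) A.≈ x
  sf x with injective⇒surjective (λ e → from-inj (s-inj (to-inj e))) (IA.to x)
  ... | i , e = A.trans (s-cong (B.trans (f-cong (A.sym (to-inj e))) (fs _))) (to-inj e)

-- Recursion on the length, splitting by the first bit. It supplies the size that regularity on a
-- code asks for.
decidable⇒finite : {X : Code n} → Decidable X → ∃ λ k → HasSize (SubsetSetoid X) k
decidable⇒finite {zero} X? with X? []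
... | yes p = 1 , record
  { to = λ _ → zero ; from = λ _ → [] , p
  ; to-cong = λ _ → refl ; from-cong = λ _ → refl
  ; inverse = (λ { {zero} _ → refl }) , λ { {[] , _} _ → refl }
  }
... | no ¬p = 0 , record
  { to = λ { ([] , p) → contradiction p ¬p } ; from = λ ()
  ; to-cong = λ { {[] , p} _ → contradiction p ¬p } ; from-cong = λ { {()} _ }
  ; inverse = (λ { {()} _ }) , λ { {[] , p} _ → contradiction p ¬p }
  }
decidable⇒finite {suc n} {X} X? with decidable⇒finite (λ x → X? (false ∷ x))
                                   | decidable⇒finite (λ x → X? (true ∷ x))
... | k₀ , I₀ | k₁ , I₁ = k₀ + k₁ , inverse byHead (↔-sym +↔⊎)
  where
  module I₀ = Inverse I₀
  module I₁ = Inverse I₁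

  to : Σ (F (suc n)) X → Fin k₀ ⊎ Fin k₁
  to (false ∷ x , p) = inj₁ (I₀.to (x , p))
  to (true  ∷ x , p) = inj₂ (I₁.to (x , p))

  from : Fin k₀ ⊎ Fin k₁ → Σ (F (suc n)) X
  from (inj₁ i) = false ∷ proj₁ (I₀.from i) , proj₂ (I₀.from i)
  from (inj₂ i) = true  ∷ proj₁ (I₁.from i) , proj₂ (I₁.from i)

  to-cong : ∀ {x y} → proj₁ x ≡ proj₁ y → to x ≡ to y
  to-cong {false ∷ x , _} {_ , _} refl = cong inj₁ (I₀.to-cong refl)
  to-cong {true  ∷ x , _} {_ , _} refl = cong inj₂ (I₁.to-cong refl)

  to-from : ∀ i → to (from i) ≡ i
  to-from (inj₁ i) = cong inj₁ (I₀.strictlyInverseˡ i)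
  to-from (inj₂ i) = cong inj₂ (I₁.strictlyInverseˡ i)

  from-to : ∀ x → proj₁ (from (to x)) ≡ proj₁ x
  from-to (false ∷ x , p) = cong (false ∷_) (I₀.strictlyInverseʳ (x , p))
  from-to (true  ∷ x , p) = cong (true  ∷_) (I₁.strictlyInverseʳ (x , p))

  byHead : Inverse (SubsetSetoid X) (≡.setoid (Fin k₀ ⊎ Fin k₁))
  byHead = record
    { to = to ; from = from ; to-cong = to-cong ; from-cong = λ { refl → refl }
    ; inverse = (λ {i} e → trans (to-cong e) (to-from i))
              , (λ { {x} refl → from-to x })
    }

-- Additive maps, parity and weight.

⊕-cancelˡ : (x y : F n) → x ⊕ (x ⊕ y) ≡ y
⊕-cancelˡ x y = trans (sym (⊕-assoc x x y)) (trans (cong (_⊕ y) (⊕-self x)) (⊕-identityˡ y))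

⊕-injectiveʳ : (x : F n) {y z : F n} → x ⊕ y ≡ x ⊕ z → y ≡ z
⊕-injectiveʳ x {y} {z} e = trans (sym (⊕-cancelˡ x y)) (trans (cong (x ⊕_) e) (⊕-cancelˡ x z))

Additive : (F m → F n) → Set
Additive f = ∀ x y → f (x ⊕ y) ≡ f x ⊕ f y

additive-𝟎 : (f : F m → F n) → Additive f → f 𝟎 ≡ 𝟎
additive-𝟎 f add = begin
  f 𝟎                ≡⟨ cong f (⊕-self 𝟎) ⟨
  f (𝟎 ⊕ 𝟎)          ≡⟨ add 𝟎 𝟎 ⟩
  f 𝟎 ⊕ f 𝟎          ≡⟨ ⊕-self (f 𝟎) ⟩
  𝟎                  ∎
  where open ≡-Reasoning

-- Over GF(2) additivity is linearity, and the unit vectors form a basis. Identities for coordinate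
-- permutations thereby reduce to one coordinate at a time.
additive-ext : (f h : F m → F n) → Additive f → Additive h →
               (∀ i → f (unit i) ≡ h (unit i)) → ∀ x → f x ≡ h x
additive-ext f h f-add h-add e [] =
  trans (additive-𝟎 f f-add) (sym (additive-𝟎 h h-add))
additive-ext f h f-add h-add e (b ∷ x) = begin
  f (b ∷ x)                  ≡⟨ cong f split ⟨
  f ((b ∷ 𝟎) ⊕ (false ∷ x))  ≡⟨ f-add (b ∷ 𝟎) (false ∷ x) ⟩
  f (b ∷ 𝟎) ⊕ f (false ∷ x)  ≡⟨ cong₂ _⊕_ (heads b) tails ⟩
  h (b ∷ 𝟎) ⊕ h (false ∷ x)  ≡⟨ h-add (b ∷ 𝟎) (false ∷ x) ⟨
  h ((b ∷ 𝟎) ⊕ (false ∷ x))  ≡⟨ cong h split ⟩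
  h (b ∷ x)                  ∎
  where
  open ≡-Reasoning
  split : (b ∷ 𝟎) ⊕ (false ∷ x) ≡ b ∷ x
  split = cong₂ _∷_ (xor-identityʳ b) (⊕-identityˡ x)

  heads : ∀ b → f (b ∷ 𝟎) ≡ h (b ∷ 𝟎)
  heads false = trans (additive-𝟎 f f-add) (sym (additive-𝟎 h h-add))
  heads true  = e zero

  tails : f (false ∷ x) ≡ h (false ∷ x)
  tails = additive-ext (λ y → f (false ∷ y)) (λ y → h (false ∷ y))
    (λ y z → f-add (false ∷ y) (false ∷ z)) (λ y z → h-add (false ∷ y) (false ∷ z))
    (λ i → e (suc i)) x

parity : F n → Bool
parity = foldr′ _xor_ false

xor-interchange : ∀ a b c d → (a xor b) xor (c xor d) ≡ (a xor c) xor (b xor d)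
xor-interchange a b c d = cong head (⊕-interchange (a ∷ []) (b ∷ []) (c ∷ []) (d ∷ []))

parity-⊕ : (x y : F n) → parity (x ⊕ y) ≡ parity x xor parity y
parity-⊕ []      []      = refl
parity-⊕ (a ∷ x) (b ∷ y) = trans (cong ((a xor b) xor_) (parity-⊕ x y))
                                 (xor-interchange a b (parity x) (parity y))

parity-𝟎 : ∀ n → parity (𝟎 {n}) ≡ false
parity-𝟎 zero    = refl
parity-𝟎 (suc n) = parity-𝟎 n

parity-unit : (i : Fin n) → parity (unit i) ≡ true
parity-unit {suc n} zero    = cong not (parity-𝟎 n)
parity-unit (suc i) = parity-unit i

parity-⊕-unit : (x : F n) (i : Fin n) → parity (x ⊕ unit i) ≡ not (parity x)
parity-⊕-unit x i = begin
  parity (x ⊕ unit i)            ≡⟨ parity-⊕ x (unit i) ⟩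
  parity x xor parity (unit i)   ≡⟨ cong (parity x xor_) (parity-unit i) ⟩
  parity x xor true              ≡⟨ xor-comm (parity x) true ⟩
  not (parity x)                 ∎
  where open ≡-Reasoning

-- Connects the divisibility condition in `ℋ` with `parity`, which, unlike `wt`, is additive.
wt-%2 : (x : F n) → wt x % 2 ≡ (if parity x then 1 else 0)
wt-%2 []          = refl
wt-%2 (false ∷ x) = wt-%2 x
wt-%2 (true ∷ x)  = trans (%-distribˡ-+ 1 (wt x) 2)
                          (trans (cong (λ p → (1 + p) % 2) (wt-%2 x)) (flip (parity x)))
  where
  flip : ∀ b → (1 + (if b then 1 else 0)) % 2 ≡ (if not b then 1 else 0)
  flip false = refl
  flip true  = refl

parity⇒even : (x : F n) → parity x ≡ false → 2 ∣ wt x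
parity⇒even x e = m%n≡0⇒n∣m (wt x) 2 (trans (wt-%2 x) (cong (if_then 1 else 0) e))

even⇒parity : (x : F n) → 2 ∣ wt x → parity x ≡ false
even⇒parity x e = decide (parity x) (trans (sym (wt-%2 x)) (n∣m⇒m%n≡0 (wt x) 2 e))
  where
  decide : ∀ b → (if b then 1 else 0) ≡ 0 → b ≡ false
  decide false _ = refl

-- Balls of radius 1 and a criterion for extended perfect codes.

wt-𝟎 : ∀ n → wt (𝟎 {n}) ≡ 0
wt-𝟎 zero    = refl
wt-𝟎 (suc n) = wt-𝟎 n

wt-unit : (i : Fin n) → wt (unit i) ≡ 1
wt-unit {suc n} zero    = cong suc (wt-𝟎 n)
wt-unit (suc i) = wt-unit i

wt≡0⇒𝟎 : (x : F n) → wt x ≡ 0 → x ≡ 𝟎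
wt≡0⇒𝟎 []          _ = refl
wt≡0⇒𝟎 (false ∷ x) e = cong (false ∷_) (wt≡0⇒𝟎 x e)

wt≤1⇒𝟎⊎unit : (x : F n) → wt x ≤ 1 → x ≡ 𝟎 ⊎ ∃ λ i → x ≡ unit i
wt≤1⇒𝟎⊎unit []          _ = inj₁ refl
wt≤1⇒𝟎⊎unit (true ∷ x)  w = inj₂ (zero , cong (true ∷_) (wt≡0⇒𝟎 x (n≤0⇒n≡0 (s≤s⁻¹ w))))
wt≤1⇒𝟎⊎unit (false ∷ x) w with wt≤1⇒𝟎⊎unit x w
... | inj₁ e       = inj₁ (cong (false ∷_) e)
... | inj₂ (i , e) = inj₂ (suc i , cong (false ∷_) e)

-- The ball of radius 1 around x, indexed by the coordinate of x extended by a
-- parity bit that has to be flipped to reach the extension of its points.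
near : Fin (suc n) → F n → F n
near zero    x = x
near (suc i) x = x ⊕ unit i

dist-near : (i : Fin (suc n)) (x : F n) → dist x (near i x) ≤ 1
dist-near {n} zero x = subst (_≤ 1) (sym (trans (cong wt (⊕-self x)) (wt-𝟎 n))) z≤n
dist-near (suc i) x  = ≤-reflexive (trans (cong wt (⊕-cancelˡ x (unit i))) (wt-unit i))

dist≤1⇒near : (x y : F n) → dist x y ≤ 1 → ∃ λ i → near i x ≡ y
dist≤1⇒near x y d with wt≤1⇒𝟎⊎unit (x ⊕ y) d
... | inj₁ e       = zero  , trans (trans (sym (⊕-identityʳ x)) (cong (x ⊕_) (sym e))) (⊕-cancelˡ x y)
... | inj₂ (i , e) = suc i , trans (cong (x ⊕_) (sym e)) (⊕-cancelˡ x y)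

-- The head `not (parity x)` is the wrong parity bit for `x`. Flipping it repairs `x` itself, while
-- a flip in the tail changes the parity of `x` and so makes the same bit correct.
extended-near : (i : Fin (suc n)) (x : F n) →
                (not (parity x) ∷ x) ⊕ unit i ≡ addParity zero (near i x)
extended-near zero x = cong₂ _∷_
  (trans (xor-comm (not (parity x)) true) (not-involutive (parity x))) (⊕-identityʳ x)
extended-near (suc i) x = cong (_∷ (x ⊕ unit i))
  (trans (xor-identityʳ (not (parity x))) (sym (parity-⊕-unit x i)))

xor≡false⇒≡ : ∀ a b → a xor b ≡ false → a ≡ b
xor≡false⇒≡ false b    e = sym e
xor≡false⇒≡ true  true e = refl

-- Puncturing the first coordinate of C gives the perfect code.
isExtendedPerfect : {C : Code n} → Fin n →
  (∀ {z} → z ∈ C → parity z ≡ false) →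
  (∀ z → parity z ≡ true → ∃ λ i → z ⊕ unit i ∈ C) →
  (∀ z {i j} → z ⊕ unit i ∈ C → z ⊕ unit j ∈ C → i ≡ j) →
  IsExtendedPerfect C
isExtendedPerfect {suc n} {C} _ even correct unique =
  extended D perfect zero (C⊆ , λ { (_ , x∈ , refl) → x∈ })
  where
  D : Code n
  D x = addParity zero x ∈ C

  C⊆ : C ⊆ image (addParity zero) D
  C⊆ {b ∷ x} z∈ = x , subst C z≡ z∈ , z≡
    where
    z≡ : b ∷ x ≡ addParity zero x
    z≡ = cong (_∷ x) (xor≡false⇒≡ b (parity x) (even z∈))

  not-xor : ∀ b → not b xor b ≡ true
  not-xor false = refl
  not-xor true  = refl

  perfect : IsPerfect D
  -- With the wrong parity bit in front of `x` the vector is odd. By `extended-near`, its single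
  -- flips that lie in `C` correspond to the elements of `D` in the ball around `x`.
  perfect x with correct (not (parity x) ∷ x) (not-xor (parity x))
  ... | i , i∈ = near i x , (subst C (extended-near i x) i∈ , dist-near i x) , only
    where
    only : ∀ {y} → y ∈ D × dist x y ≤ 1 → near i x ≡ y
    only {y} (y∈ , d) with dist≤1⇒near x y d
    ... | j , refl = cong (λ l → near l x)
      (unique (not (parity x) ∷ x) i∈ (subst C (sym (extended-near j x)) y∈))

-- Affine groups and a criterion for propelinear codes.

module AffineProperties (Q : AdditiveAction n) where
  open AdditiveAction Q using (⋆-cong; ⋆-ε)
  open Affine Q public
  open Group affineGroup public using (Carrier; _≈_; _∙_; ε; _⁻¹; inverseˡ; inverseʳ)

  ▷-cong : ∀ {g h} → g ≈ h → ∀ y → g ▷ y ≡ h ▷ y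
  ▷-cong (e , f) y = cong₂ _⊕_ e (⋆-cong f y)

  ▷-ε : ∀ y → ε ▷ y ≡ y
  ▷-ε y = trans (⊕-identityˡ _) (⋆-ε y)

  ▷-inverseˡ : ∀ g y → (g ⁻¹) ▷ g ▷ y ≡ y
  ▷-inverseˡ g y =
    trans (sym (▷-∘ᴬ (g ⁻¹) g y)) (trans (▷-cong (inverseˡ g) y) (▷-ε y))

  ▷-inverseʳ : ∀ g y → g ▷ (g ⁻¹) ▷ y ≡ y
  ▷-inverseʳ g y =
    trans (sym (▷-∘ᴬ g (g ⁻¹) y)) (trans (▷-cong (inverseʳ g) y) (▷-ε y))

  ▷-injective : ∀ g {x y} → g ▷ x ≡ g ▷ y → x ≡ y
  ▷-injective g {x} {y} e =
    trans (sym (▷-inverseˡ g x)) (trans (cong (g ⁻¹ ▷_) e) (▷-inverseˡ g y))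

  ▷-bijection : Carrier → F n ↔ F n
  ▷-bijection g = mk↔ₛ′ (g ▷_) (g ⁻¹ ▷_) (▷-inverseʳ g) (▷-inverseˡ g)

  ▷-𝟎 : ∀ g → g ▷ 𝟎 ≡ proj₁ g
  ▷-𝟎 (x , q) = trans (cong (x ⊕_) (⋆-𝟎 q)) (⊕-identityʳ x)

-- The transformations (x , π x) with x ∈ C form a group that acts regularly.
isPropelinear : {C : Code n} → Decidable C → 𝟎 ∈ C →
  (π : F n → Permutation′ n) → let _▷_ = AutF._▷_ n in
  (∀ {x y} → x ∈ C → y ∈ C → ((x , π x) ▷ y) ∈ C) →
  (∀ {x} → x ∈ C → ∀ y → ((x , π x) ▷ y) ∈ C → y ∈ C) →
  (∀ {x y} → x ∈ C → y ∈ C → π ((x , π x) ▷ y) Perm.≈ (π y ∘ₚ π x)) →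
  IsPropelinear C
isPropelinear {n} {C} C? 𝟎∈ π closed reflected π-homo = H , (λ {g} → H⊆Aut {g}) , regular
  where
  open AffineProperties (permutationAction n)
  module P = Group (permutationGroup n)
  open GroupProperties (permutationGroup n) using (identityˡ-unique; inverseʳ-unique)

  -- The permutation is prescribed only up to pointwise equality, since a `Subgroup` has to respect
  -- `_≈_`.
  Mem : Carrier → Set
  Mem (x , ρ) = x ∈ C × ρ Perm.≈ π x

  π-cong : ∀ {x y} → x ≡ y → π x Perm.≈ π y
  π-cong e i = cong (λ z → π z ⟨$⟩ʳ i) e

  ▷-π : ∀ x ρ → Mem (x , ρ) → ∀ y → (x , ρ) ▷ y ≡ (x , π x) ▷ y
  ▷-π x ρ (_ , e) = ▷-cong {x , ρ} {x , π x} (refl , e)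

  π-𝟎 : π 𝟎 Perm.≈ Perm.id
  -- As `(𝟎 , π 𝟎)` fixes `𝟎`, the homomorphism rule makes `π 𝟎` idempotent, hence the identity.
  π-𝟎 = identityˡ-unique (π 𝟎) (π 𝟎)
    λ i → trans (sym (π-homo 𝟎∈ 𝟎∈ i)) (π-cong (▷-𝟎 (𝟎 , π 𝟎)) i)

  ▷-closed : ∀ g → Mem g → ∀ {y} → y ∈ C → (g ▷ y) ∈ C
  ▷-closed (x , ρ) g∈ {y} y∈ = subst C (sym (▷-π x ρ g∈ y)) (closed (proj₁ g∈) y∈)

  ∙-closed : ∀ g h → Mem g → Mem h → Mem (g ∙ h)
  ∙-closed (x , ρ) (y , σ) g∈@(x∈ , ρ≈) (y∈ , σ≈) = ▷-closed (x , ρ) g∈ y∈ ,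
    λ i → trans (P.∙-cong {ρ} {π x} {σ} {π y} ρ≈ σ≈ i)
      (trans (sym (π-homo x∈ y∈ i)) (π-cong (sym (▷-π x ρ g∈ y)) i))

  ⁻¹-closed : ∀ g → Mem g → Mem (g ⁻¹)
  ⁻¹-closed (x , ρ) g∈@(x∈ , ρ≈) = y∈ ,
    λ i → trans (P.⁻¹-cong {ρ} {π x} ρ≈ i) (sym (inverseʳ-unique (π x) (π y) πxπy i))
    where
    y = proj₁ ((x , ρ) ⁻¹)

    x▷y : (x , π x) ▷ y ≡ 𝟎
    x▷y = trans (sym (▷-π x ρ g∈ y)) (proj₁ (inverseʳ (x , ρ)))

    y∈ : y ∈ C
    -- `y` is the preimage of the codeword `𝟎` under `(x , π x)`.
    y∈ = reflected x∈ y (subst C (sym x▷y) 𝟎∈)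

    πxπy : (π y ∘ₚ π x) Perm.≈ Perm.id
    πxπy i = trans (sym (π-homo x∈ y∈ i)) (trans (π-cong x▷y i) (π-𝟎 i))

  H : Subgroup (AutF n) 0ℓ
  H = record
    { Mem       = Mem
    ; resp      = λ { (refl , e) (x∈ , ρ≈) → x∈ , λ i → trans (sym (e i)) (ρ≈ i) }
    ; ∙-closed  = λ {g} {h} → ∙-closed g h
    ; ε-closed  = 𝟎∈ , λ i → sym (π-𝟎 i)
    ; ⁻¹-closed = λ {g} → ⁻¹-closed g
    }

  H⊆Aut : Mem ⊆ Aut C
  H⊆Aut {g} g∈ =
    (λ { (x , x∈ , refl) → ▷-closed g g∈ x∈ }) ,
    λ {y} y∈ → (g ⁻¹) ▷ y , ▷-closed (g ⁻¹) (⁻¹-closed g g∈) y∈ , sym (▷-inverseʳ g y)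

  elem : F n → Carrier
  elem x = x , π x

  elem-closed : ∀ {x} → x ∈ C → Mem (elem x)
  elem-closed x∈ = x∈ , λ _ → refl

  size : ∃ λ k → HasSize (SubsetSetoid C) k
  size = decidable⇒finite C?

  -- An element of `H` is determined up to `_≈_` by its translation part, so `H` has the size of
  -- `C`.
  translation : Inverse (Group.setoid (Subgroup.group H)) (SubsetSetoid C)
  translation = record
    { to        = λ ((x , _) , (x∈ , _)) → x , x∈
    ; from      = λ (x , x∈) → elem x , elem-closed x∈
    ; to-cong   = proj₁
    ; from-cong = λ e → e , π-cong e
    ; inverse   = proj₁ , λ { {(x , ρ) , (x∈ , ρ≈)} refl → refl , λ i → sym (ρ≈ i) }
    }

  regular : IsRegularOn H _▷_ C
  regular = record
    { transitive = λ {x} {y} x∈ y∈ →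
        -- `elem x` maps `𝟎` to `x` and `elem y` maps it to `y`, so the route from `x` to `y` passes
        -- through `𝟎`.
        (elem y ∙ (elem x ⁻¹) ,
         ∙-closed (elem y) (elem x ⁻¹) (elem-closed y∈) (⁻¹-closed (elem x) (elem-closed x∈))) ,
        (begin
          (elem y ∙ (elem x ⁻¹)) ▷ x         ≡⟨ ▷-∘ᴬ (elem y) (elem x ⁻¹) x ⟩
          elem y ▷ (elem x ⁻¹) ▷ x           ≡⟨ cong (λ z → elem y ▷ (elem x ⁻¹) ▷ z) (▷-𝟎 (elem x)) ⟨
          elem y ▷ (elem x ⁻¹) ▷ elem x ▷ 𝟎  ≡⟨ cong (elem y ▷_) (▷-inverseˡ (elem x) 𝟎) ⟩
          elem y ▷ 𝟎                         ≡⟨ ▷-𝟎 (elem y) ⟩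
          y                                  ∎)
    ; order≡size = proj₁ size , inverse translation (proj₂ size) , proj₂ size
    }
    where open ≡-Reasoning

-- Coordinate permutations of single vectors and of concatenations.

permute-unit : (π : Permutation′ n) (i : Fin n) → permute π (unit i) ≡ unit (π ⟨$⟩ʳ i)
permute-unit π i = trans (tabulate-cong entry) (tabulate∘lookup (unit (π ⟨$⟩ʳ i)))
  where
  lookup-𝟎 : ∀ {n} (k : Fin n) → lookup 𝟎 k ≡ false
  lookup-𝟎 zero    = refl
  lookup-𝟎 (suc k) = lookup-𝟎 k

  entry : ∀ k → lookup (unit i) (π ⟨$⟩ˡ k) ≡ lookup (unit (π ⟨$⟩ʳ i)) k
  entry k with k Fin.≟ π ⟨$⟩ʳ i
  ... | yes refl = trans (cong (lookup (unit i)) (Perm.inverseˡ π))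
    (trans (lookup∘update i 𝟎 true) (sym (lookup∘update (π ⟨$⟩ʳ i) 𝟎 true)))
  ... | no k≢ = trans (lookup∘update′ (λ e → k≢ (trans (sym (Perm.inverseʳ π)) (cong (π ⟨$⟩ʳ_) e))) 𝟎 true)
    (trans (lookup-𝟎 (π ⟨$⟩ˡ k)) (sym (trans (lookup∘update′ k≢ 𝟎 true) (lookup-𝟎 k))))

permute-⊕ : (π : Permutation′ n) → Additive (permute π)
permute-⊕ π = AdditiveAction.⋆-⊕ (permutationAction _) π

parity-permute : (π : Permutation′ n) (x : F n) → parity (permute π x) ≡ parity x
-- `additive-ext` concerns vector-valued maps, so the parity is read as a vector of length one.
parity-permute π x = cong head (additive-ext
  (λ x → parity (permute π x) ∷ []) (λ x → parity x ∷ [])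
  (λ x y → cong (_∷ []) (trans (cong parity (permute-⊕ π x y)) (parity-⊕ (permute π x) (permute π y))))
  (λ x y → cong (_∷ []) (parity-⊕ x y))
  (λ i → cong (_∷ []) (trans (cong parity (permute-unit π i))
                             (trans (parity-unit (π ⟨$⟩ʳ i)) (sym (parity-unit i)))))
  x)

infixr 5 _⊕ₚ_

_⊕ₚ_ : Permutation′ m → Permutation′ n → Permutation′ (m + n)
π ⊕ₚ ρ = ↔-sym +↔⊎ ↔-∘ ((π ⊎-↔ ρ) ↔-∘ +↔⊎)

⊕ₚ-cong : {π π′ : Permutation′ m} {ρ ρ′ : Permutation′ n} →
          π Perm.≈ π′ → ρ Perm.≈ ρ′ → (π ⊕ₚ ρ) Perm.≈ (π′ ⊕ₚ ρ′)
⊕ₚ-cong {m} e f i with splitAt m i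
... | inj₁ j = cong (_↑ˡ _) (e j)
... | inj₂ j = cong (_ ↑ʳ_) (f j)

⊕ₚ-∘ₚ : (π π′ : Permutation′ m) (ρ ρ′ : Permutation′ n) →
        ((π ∘ₚ π′) ⊕ₚ (ρ ∘ₚ ρ′)) Perm.≈ ((π ⊕ₚ ρ) ∘ₚ (π′ ⊕ₚ ρ′))
⊕ₚ-∘ₚ {m} {n} π π′ ρ ρ′ i with splitAt m i
... | inj₁ j rewrite splitAt-↑ˡ m (π ⟨$⟩ʳ j) n = refl
... | inj₂ j rewrite splitAt-↑ʳ m n (ρ ⟨$⟩ʳ j) = refl

module _ {m n : ℕ} where
  lookup-↑ˡ : (z : F (m + n)) (i : Fin m) → lookup z (i ↑ˡ n) ≡ lookup (take m z) i
  lookup-↑ˡ z i = trans (cong (λ w → lookup w (i ↑ˡ n)) (sym (take++drop≡id m z)))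
                        (lookup-++ˡ (take m z) (drop m z) i)

  lookup-↑ʳ : (z : F (m + n)) (i : Fin n) → lookup z (m ↑ʳ i) ≡ lookup (drop m z) i
  lookup-↑ʳ z i = trans (cong (λ w → lookup w (m ↑ʳ i)) (sym (take++drop≡id m z)))
                        (lookup-++ʳ (take m z) (drop m z) i)

  take-++ : (x : F m) (y : F n) → take m (x ++ y) ≡ x
  take-++ x y = proj₁ (++-injective _ x (take++drop≡id m (x ++ y)))

  drop-++ : (x : F m) (y : F n) → drop m (x ++ y) ≡ y
  drop-++ x y = proj₂ (++-injective _ x (take++drop≡id m (x ++ y)))

  take-permute : (π : Permutation′ m) (ρ : Permutation′ n) (z : F (m + n)) →
                 take m (permute (π ⊕ₚ ρ) z) ≡ permute π (take m z)
  take-permute π ρ z =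
    trans (sym (tabulate∘lookup (take m (permute (π ⊕ₚ ρ) z)))) (tabulate-cong entry)
    where
    entry : ∀ i → lookup (take m (permute (π ⊕ₚ ρ) z)) i ≡ lookup (take m z) (π ⟨$⟩ˡ i)
    entry i = trans (sym (lookup-↑ˡ (permute (π ⊕ₚ ρ) z) i))
      (trans (lookup∘tabulate (λ k → lookup z ((π ⊕ₚ ρ) ⟨$⟩ˡ k)) (i ↑ˡ n)) step)
      where
      step : lookup z ((π ⊕ₚ ρ) ⟨$⟩ˡ (i ↑ˡ n)) ≡ lookup (take m z) (π ⟨$⟩ˡ i)
      step rewrite splitAt-↑ˡ m i n = lookup-↑ˡ z (π ⟨$⟩ˡ i)

  drop-permute : (π : Permutation′ m) (ρ : Permutation′ n) (z : F (m + n)) →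
                 drop m (permute (π ⊕ₚ ρ) z) ≡ permute ρ (drop m z)
  drop-permute π ρ z =
    trans (sym (tabulate∘lookup (drop m (permute (π ⊕ₚ ρ) z)))) (tabulate-cong entry)
    where
    entry : ∀ i → lookup (drop m (permute (π ⊕ₚ ρ) z)) i ≡ lookup (drop m z) (ρ ⟨$⟩ˡ i)
    entry i = trans (sym (lookup-↑ʳ (permute (π ⊕ₚ ρ) z) i))
      (trans (lookup∘tabulate (λ k → lookup z ((π ⊕ₚ ρ) ⟨$⟩ˡ k)) (m ↑ʳ i)) step)
      where
      step : lookup z ((π ⊕ₚ ρ) ⟨$⟩ˡ (m ↑ʳ i)) ≡ lookup (drop m z) (ρ ⟨$⟩ˡ i)
      step rewrite splitAt-↑ʳ m n i = lookup-↑ʳ z (ρ ⟨$⟩ˡ i)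

++-𝟎 : ∀ m → 𝟎 {m} ++ 𝟎 {n} ≡ 𝟎
++-𝟎 zero    = refl
++-𝟎 (suc m) = cong (false ∷_) (++-𝟎 m)

unit-↑ˡ : (i : Fin m) → unit (i ↑ˡ n) ≡ unit i ++ 𝟎
unit-↑ˡ {suc m} zero = cong (true ∷_) (sym (++-𝟎 m))
unit-↑ˡ (suc i)      = cong (false ∷_) (unit-↑ˡ i)

unit-↑ʳ : ∀ m (i : Fin n) → unit (m ↑ʳ i) ≡ 𝟎 {m} ++ unit i
unit-↑ʳ zero    i = refl
unit-↑ʳ (suc m) i = cong (false ∷_) (unit-↑ʳ m i)

parity-++ : (x : F m) (y : F n) → parity (x ++ y) ≡ parity x xor parity y
parity-++ []      y = refl
parity-++ (b ∷ x) y = trans (cong (b xor_) (parity-++ x y)) (sym (xor-assoc b (parity x) (parity y)))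

-- Syndromes and the translates of the extended Hamming code.

∑-tabulate : (f : Fin m → F n) (c : F m) →
             ∑ (tabulate λ i → lookup c i · f i) ≡ tabulate f *ᵥ c
∑-tabulate f []      = refl
∑-tabulate f (b ∷ c) = cong (b · f zero ⊕_) (∑-tabulate (f ∘ suc) c)

module Syndrome (r : ℕ) where
  open Inverse (vector r) public using ()
    renaming (to to vec; from to index;
              strictlyInverseˡ to vec-index; strictlyInverseʳ to index-vec)
  open AffineProperties (linearAction r)

  -- The columns of `tabulate vec` run through all vectors of F^r, so `∑supp` is a syndrome map and
  -- inherits additivity from the matrix product.
  ∑supp-matrix : ∀ c → ∑supp {r} c ≡ tabulate vec *ᵥ c
  ∑supp-matrix = ∑-tabulate vec

  ∑supp-⊕ : ∀ c d → ∑supp {r} (c ⊕ d) ≡ ∑supp {r} c ⊕ ∑supp {r} d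
  ∑supp-⊕ c d = trans (∑supp-matrix (c ⊕ d)) (trans (*ᵥ-⊕ _ c d)
    (sym (cong₂ _⊕_ (∑supp-matrix c) (∑supp-matrix d))))

  ∑supp-unit : ∀ i → ∑supp {r} (unit i) ≡ vec i
  ∑supp-unit i = trans (∑supp-matrix (unit i)) (trans (*ᵥ-unit _ i) (lookup∘tabulate vec i))

  ∑supp-𝟎 : ∑supp {r} 𝟎 ≡ 𝟎
  ∑supp-𝟎 = additive-𝟎 (∑supp {r}) ∑supp-⊕

  ∑supp-e : (a : F r) → ∑supp {r} e[ a ] ≡ a
  ∑supp-e a = trans (∑supp-unit (index a)) (vec-index a)

  affinePermutation : Carrier → Permutation′ (2 ^ r)
  affinePermutation g = ↔-sym (vector r) ↔-∘ (▷-bijection g ↔-∘ vector r)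

  affinePermutation-cong : ∀ g h → g ≈ h → affinePermutation g Perm.≈ affinePermutation h
  affinePermutation-cong g h e i = cong index (▷-cong {g} {h} e (vec i))

  affinePermutation-∙ : ∀ g h →
    affinePermutation (g ∙ h) Perm.≈ (affinePermutation h ∘ₚ affinePermutation g)
  affinePermutation-∙ g h i = cong index
    (trans (▷-∘ᴬ g h (vec i)) (cong (g ▷_) (sym (vec-index (h ▷ vec i)))))

  -- Both sides are additive, so unit vectors suffice. Every coordinate in the support contributes
  -- one copy of the translation part, of which only the parity of their number remains.
  ∑supp-permute : ∀ g c → ∑supp {r} (permute (affinePermutation g) c) ≡
                          parity c · proj₁ g ⊕ GLMatrix.mat (proj₂ g) *ᵥ ∑supp {r} c
  ∑supp-permute g@(a , M) = additive-ext _ _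
    (λ c d → trans (cong (∑supp {r}) (permute-⊕ π c d)) (∑supp-⊕ (permute π c) (permute π d)))
    (λ c d → trans
      (cong₂ _⊕_ (trans (cong (_· a) (parity-⊕ c d)) (·-xor (parity c) (parity d) a))
                 (trans (cong (A *ᵥ_) (∑supp-⊕ c d)) (*ᵥ-⊕ A (∑supp {r} c) (∑supp {r} d))))
      (⊕-interchange (parity c · a) (parity d · a) (A *ᵥ ∑supp {r} c) (A *ᵥ ∑supp {r} d)))
    (λ i → begin
      ∑supp {r} (permute π (unit i))                             ≡⟨ cong (∑supp {r}) (permute-unit π i) ⟩
      ∑supp {r} (unit (π ⟨$⟩ʳ i))                                ≡⟨ ∑supp-unit (π ⟨$⟩ʳ i) ⟩
      vec (index (g ▷ vec i))                                    ≡⟨ vec-index (g ▷ vec i) ⟩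
      a ⊕ A *ᵥ vec i                                             ≡⟨ cong₂ (λ v w → v ⊕ A *ᵥ w) (·-true a) (∑supp-unit i) ⟨
      true · a ⊕ A *ᵥ ∑supp {r} (unit i)                         ≡⟨ cong (λ b → b · a ⊕ A *ᵥ ∑supp {r} (unit i)) (parity-unit i) ⟨
      parity (unit i) · a ⊕ A *ᵥ ∑supp {r} (unit i)              ∎)
    where
    open ≡-Reasoning
    π = affinePermutation g
    A = GLMatrix.mat M

  -- Evenness of `c` cancels the translation part contributed by the permutation, and the syndrome
  -- of `u` restores it.
  ∑supp-▷ : ∀ g u c → ∑supp {r} u ≡ proj₁ g → parity c ≡ false →
            ∑supp {r} (u ⊕ permute (affinePermutation g) c) ≡ g ▷ ∑supp {r} c
  ∑supp-▷ g@(a , M) u c u≡ even = begin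
    ∑supp {r} (u ⊕ permute (affinePermutation g) c)              ≡⟨ ∑supp-⊕ u _ ⟩
    ∑supp {r} u ⊕ ∑supp {r} (permute (affinePermutation g) c)    ≡⟨ cong₂ _⊕_ u≡ (∑supp-permute g c) ⟩
    a ⊕ (parity c · a ⊕ A *ᵥ ∑supp {r} c)                        ≡⟨ cong (λ b → a ⊕ (b · a ⊕ A *ᵥ ∑supp {r} c)) even ⟩
    a ⊕ (false · a ⊕ A *ᵥ ∑supp {r} c)                           ≡⟨ cong (λ v → a ⊕ (v ⊕ A *ᵥ ∑supp {r} c)) (·-false a) ⟩
    a ⊕ (𝟎 ⊕ A *ᵥ ∑supp {r} c)                                   ≡⟨ cong (a ⊕_) (⊕-identityˡ _) ⟩
    g ▷ ∑supp {r} c                                              ∎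
    where
    open ≡-Reasoning
    A = GLMatrix.mat M

  -- Each of the two added unit vectors flips the parity and adds its index to the syndrome: the
  -- parity survives and the syndrome moves from `𝟎` to `a`.
  ℋ⇒ : ∀ {a c} → c ∈ ℋ[_] {r} a → parity c ≡ false × ∑supp {r} c ≡ a
  ℋ⇒ {a} (_ , (c , (c≡𝟎 , even) , refl) , refl) =
    (begin
      parity ((c ⊕ e[ a ]) ⊕ e[ 𝟎 {r} ])  ≡⟨ parity-⊕-unit (c ⊕ e[ a ]) _ ⟩
      not (parity (c ⊕ e[ a ]))           ≡⟨ cong not (parity-⊕-unit c _) ⟩
      not (not (parity c))                ≡⟨ not-involutive (parity c) ⟩
      parity c                            ≡⟨ even⇒parity c even ⟩
      false                               ∎) ,
    (begin
      ∑supp {r} ((c ⊕ e[ a ]) ⊕ e[ 𝟎 {r} ])                   ≡⟨ ∑supp-⊕ (c ⊕ e[ a ]) e[ 𝟎 {r} ] ⟩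
      ∑supp {r} (c ⊕ e[ a ]) ⊕ ∑supp {r} e[ 𝟎 {r} ]           ≡⟨ cong₂ _⊕_ (∑supp-⊕ c _) (∑supp-e 𝟎) ⟩
      (∑supp {r} c ⊕ ∑supp {r} e[ a ]) ⊕ 𝟎                    ≡⟨ ⊕-identityʳ _ ⟩
      ∑supp {r} c ⊕ ∑supp {r} e[ a ]                          ≡⟨ cong₂ _⊕_ c≡𝟎 (∑supp-e a) ⟩
      𝟎 ⊕ a                                                   ≡⟨ ⊕-identityˡ a ⟩
      a                                                       ∎)
    where open ≡-Reasoning

  ⇒ℋ : ∀ c → parity c ≡ false → c ∈ ℋ[_] {r} (∑supp {r} c)
  ⇒ℋ c even = c ⊕ e[ 𝟎 {r} ] , (d , (d≡𝟎 , parity⇒even d d-even) , undo _ e[ a ]) , undo c _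
    where
    open ≡-Reasoning
    a = ∑supp {r} c
    -- Adding the two unit vectors once more, in the reverse order, leads back into `ℋ`.
    d = (c ⊕ e[ 𝟎 {r} ]) ⊕ e[ a ]

    undo : ∀ {n} (x y : F n) → x ≡ (x ⊕ y) ⊕ y
    undo x y = sym (trans (⊕-assoc x y y) (trans (cong (x ⊕_) (⊕-self y)) (⊕-identityʳ x)))

    d≡𝟎 : ∑supp {r} d ≡ 𝟎
    d≡𝟎 = begin
      ∑supp {r} d                                              ≡⟨ ∑supp-⊕ (c ⊕ e[ 𝟎 {r} ]) e[ a ] ⟩
      ∑supp {r} (c ⊕ e[ 𝟎 {r} ]) ⊕ ∑supp {r} e[ a ]            ≡⟨ cong₂ _⊕_ (∑supp-⊕ c _) (∑supp-e a) ⟩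
      (a ⊕ ∑supp {r} e[ 𝟎 {r} ]) ⊕ a                           ≡⟨ cong (λ v → (a ⊕ v) ⊕ a) (∑supp-e 𝟎) ⟩
      (a ⊕ 𝟎) ⊕ a                                              ≡⟨ cong (_⊕ a) (⊕-identityʳ a) ⟩
      a ⊕ a                                                    ≡⟨ ⊕-self a ⟩
      𝟎                                                        ∎

    d-even : parity d ≡ false
    d-even = begin
      parity d                           ≡⟨ parity-⊕-unit (c ⊕ e[ 𝟎 {r} ]) _ ⟩
      not (parity (c ⊕ e[ 𝟎 {r} ]))      ≡⟨ cong not (parity-⊕-unit c _) ⟩
      not (not (parity c))               ≡⟨ not-involutive (parity c) ⟩
      parity c                           ≡⟨ even ⟩
      false                              ∎

↑ˡ-or-↑ʳ : ∀ m (i : Fin (m + n)) → (∃ λ j → j ↑ˡ n ≡ i) ⊎ ∃ λ j → m ↑ʳ j ≡ i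
↑ˡ-or-↑ʳ m i with splitAt m i in e
... | inj₁ j = inj₁ (j , splitAt⁻¹-↑ˡ e)
... | inj₂ j = inj₂ (j , splitAt⁻¹-↑ʳ e)

-- Regular subgroups and the permutations induced by their automorphisms.

module _ {r : ℕ} (G : Subgroup (GA r) 0ℓ) (regular : IsRegularSubgroup G) where
  open RegularSubgroup G regular using (g[_])
  open AffineProperties (linearAction r)
  private module G = Group (Subgroup.group G)

  γ : F r → Carrier
  γ a = proj₁ g[ a ]

  γ-▷𝟎 : ∀ a → γ a ▷ 𝟎 ≡ a
  γ-▷𝟎 a = proj₂ (IsRegularOn.transitive regular {𝟎} {a} _ _)

  -- Evaluation at `𝟎` has the section `g[_]`, and G has as many elements as F^r, so the two are
  -- inverse to each other. This is the uniqueness of `g[ a ]`.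
  ▷𝟎-injective : ∀ g h → proj₁ g ▷ 𝟎 ≡ proj₁ h ▷ 𝟎 → g G.≈ h
  ▷𝟎-injective g h e with IsRegularOn.order≡size regular
  ... | _ , IG , IU = split-epi⇒injective {A = G.setoid} {SubsetSetoid U} IG IU
    (λ g → proj₁ g ▷ 𝟎 , _) (λ {g} {h} e → ▷-cong {proj₁ g} {proj₁ h} e 𝟎)
    (λ (a , _) → g[ a ]) (λ { refl → G.refl {g[ _ ]} })
    (λ (a , _) → γ-▷𝟎 a) {g} {h} e

  -- Both sides map `𝟎` to `γ a ▷ b`.
  γ-∙ : ∀ a b → γ (γ a ▷ b) ≈ γ a ∙ γ b
  γ-∙ a b = ▷𝟎-injective g[ γ a ▷ b ] (g[ a ] G.∙ g[ b ]) (begin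
    γ (γ a ▷ b) ▷ 𝟎     ≡⟨ γ-▷𝟎 (γ a ▷ b) ⟩
    γ a ▷ b             ≡⟨ cong (γ a ▷_) (γ-▷𝟎 b) ⟨
    γ a ▷ γ b ▷ 𝟎       ≡⟨ ▷-∘ᴬ (γ a) (γ b) 𝟎 ⟨
    (γ a ∙ γ b) ▷ 𝟎     ∎)
    where open ≡-Reasoning

  γ-translation : ∀ a → proj₁ (γ a) ≡ a
  γ-translation a = trans (sym (▷-𝟎 (γ a))) (γ-▷𝟎 a)

  module InducedPermutation
    {T : G.Carrier → G.Carrier} (iso : RegularSubgroup.IsAutomorphism G regular T)
    {τ : F r → F r} (induces : RegularSubgroup.Induces G regular T τ) where
    open IsGroupIsomorphism iso

    -- Apply `T` to `γ-∙` and evaluate at `𝟎`. Thus `τ` intertwines the actions of `γ a` and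
    -- `γ (τ a)`.
    τ-▷ : ∀ a b → τ (γ a ▷ b) ≡ γ (τ a) ▷ τ b
    τ-▷ a b = begin
      τ (γ a ▷ b)                         ≡⟨ γ-▷𝟎 (τ (γ a ▷ b)) ⟨
      γ (τ (γ a ▷ b)) ▷ 𝟎                 ≡⟨ at𝟎 (T g[ γ a ▷ b ]) g[ τ (γ a ▷ b) ] (induces (γ a ▷ b)) ⟨
      proj₁ (T g[ γ a ▷ b ]) ▷ 𝟎          ≡⟨ at𝟎 (T g[ γ a ▷ b ]) (T (g[ a ] G.∙ g[ b ])) (⟦⟧-cong (γ-∙ a b)) ⟩
      proj₁ (T (g[ a ] G.∙ g[ b ])) ▷ 𝟎   ≡⟨ at𝟎 (T (g[ a ] G.∙ g[ b ])) (T g[ a ] G.∙ T g[ b ]) (∙-homo g[ a ] g[ b ]) ⟩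
      proj₁ (T g[ a ] G.∙ T g[ b ]) ▷ 𝟎   ≡⟨ at𝟎 (T g[ a ] G.∙ T g[ b ]) (g[ τ a ] G.∙ g[ τ b ])
                                              (G.∙-cong {T g[ a ]} {g[ τ a ]} {T g[ b ]} {g[ τ b ]} (induces a) (induces b)) ⟩
      (γ (τ a) ∙ γ (τ b)) ▷ 𝟎             ≡⟨ ▷-∘ᴬ (γ (τ a)) (γ (τ b)) 𝟎 ⟩
      γ (τ a) ▷ γ (τ b) ▷ 𝟎               ≡⟨ cong (γ (τ a) ▷_) (γ-▷𝟎 (τ b)) ⟩
      γ (τ a) ▷ τ b                       ∎
      where
      open ≡-Reasoning
      at𝟎 : ∀ g h → g G.≈ h → proj₁ g ▷ 𝟎 ≡ proj₁ h ▷ 𝟎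
      at𝟎 g h e = ▷-cong {proj₁ g} {proj₁ h} e 𝟎

    γ-injective : ∀ a b → γ a ≈ γ b → a ≡ b
    γ-injective a b e = trans (sym (γ-▷𝟎 a)) (trans (▷-cong {γ a} {γ b} e 𝟎) (γ-▷𝟎 b))

    τ-injective : ∀ {a b} → τ a ≡ τ b → a ≡ b
    τ-injective {a} {b} e = γ-injective a b (injective (begin
      T g[ a ]   ≈⟨ induces a ⟩
      g[ τ a ]   ≡⟨ cong g[_] e ⟩
      g[ τ b ]   ≈⟨ induces b ⟨
      T g[ b ]   ∎))
      where open import Relation.Binary.Reasoning.Setoid G.setoid

    τ-surjective : ∀ b → ∃ λ a → τ a ≡ b
    τ-surjective b with surjective g[ b ]
    ... | g , T≈ = a , γ-injective (τ a) b (begin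
      g[ τ a ]   ≈⟨ induces a ⟨
      T g[ a ]   ≈⟨ T≈ (▷𝟎-injective g[ a ] g (γ-▷𝟎 a)) ⟩
      g[ b ]     ∎)
      where
      -- By uniqueness the preimage `g` under `T` equals `g[ a ]` for this `a`.
      a = proj₁ g ▷ 𝟎
      open import Relation.Binary.Reasoning.Setoid G.setoid

    -- `γ (τ 𝟎)` maps both `τ 𝟎` and `𝟎` to `τ 𝟎`. This is what puts the zero vector into the code.
    τ-𝟎 : τ 𝟎 ≡ 𝟎
    τ-𝟎 = ▷-injective (γ (τ 𝟎)) (begin
      γ (τ 𝟎) ▷ τ 𝟎   ≡⟨ τ-▷ 𝟎 𝟎 ⟨
      τ (γ 𝟎 ▷ 𝟎)     ≡⟨ cong τ (γ-▷𝟎 𝟎) ⟩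
      τ 𝟎             ≡⟨ γ-▷𝟎 (τ 𝟎) ⟨
      γ (τ 𝟎) ▷ 𝟎     ∎)
      where open ≡-Reasoning

    -- The union code and its regular group.

    open Syndrome r

    private N = 2 ^ r

    Union : Code (N + N)
    Union = ⋃[ a ∶ F r ] (ℋ[ a ] ×ᶜ ℋ[ τ a ])

    left right : F (N + N) → F N
    left  = take N
    right = drop N

    -- Membership in the union without the existential over `a`, which is forced to be the syndrome
    -- of the left half. In this form it is plainly decidable.
    record Matched (x y : F N) : Set where
      constructor matched
      field
        even₁ : parity x ≡ false
        even₂ : parity y ≡ false
        τ-∑   : τ (∑supp {r} x) ≡ ∑supp {r} y

    open Matched

    Union⇒Matched : ∀ {z} → z ∈ Union → Matched (left z) (right z)
    Union⇒Matched (a , x , y , x∈ , y∈ , refl)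
      rewrite take-++ x y | drop-++ x y with ℋ⇒ {a} x∈ | ℋ⇒ {τ a} y∈
    ... | ex , sx | ey , sy = matched ex ey (trans (cong τ sx) (sym sy))

    Matched⇒Union : ∀ z → Matched (left z) (right z) → z ∈ Union
    Matched⇒Union z M = ∑supp {r} (left z) , left z , right z , ⇒ℋ (left z) (even₁ M) ,
      subst (λ b → right z ∈ ℋ[_] {r} b) (sym (τ-∑ M)) (⇒ℋ (right z) (even₂ M)) ,
      sym (take++drop≡id N z)

    matched? : ∀ x y → Dec (Matched x y)
    matched? x y = map′ (λ ((p , q) , e) → matched p q e) (λ (matched p q e) → (p , q) , e)
      ((parity x Bool.≟ false ×-dec parity y Bool.≟ false)
        ×-dec ≡-dec Bool._≟_ (τ (∑supp {r} x)) (∑supp {r} y))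

    union? : Decidable Union
    union? z = map′ (Matched⇒Union z) Union⇒Matched (matched? (left z) (right z))

    π : F N → Permutation′ N
    π x = affinePermutation (γ (∑supp {r} x))

    act : F N → F N → F N
    act x y = x ⊕ permute (π x) y

    ∑supp-act : ∀ x y → parity y ≡ false → ∑supp {r} (act x y) ≡ γ (∑supp {r} x) ▷ ∑supp {r} y
    ∑supp-act x y = ∑supp-▷ (γ (∑supp {r} x)) x y (sym (γ-translation (∑supp {r} x)))

    parity-act : ∀ x y → parity x ≡ false → parity (act x y) ≡ parity y
    parity-act x y e = trans (parity-⊕ x (permute (π x) y))
      (trans (cong (_xor parity (permute (π x) y)) e) (parity-permute (π x) y))

    -- `γ-∙` transported to coordinates; evenness of `y` enters through the syndrome of `act x y`.
    π-act : ∀ x y → parity y ≡ false → π (act x y) Perm.≈ (π y ∘ₚ π x)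
    π-act x y e i = trans (cong (λ s → affinePermutation (γ s) ⟨$⟩ʳ i) (∑supp-act x y e))
      (trans (affinePermutation-cong (γ (γ a ▷ b)) (γ a ∙ γ b) (γ-∙ a b) i)
             (affinePermutation-∙ (γ a) (γ b) i))
      where
      a = ∑supp {r} x
      b = ∑supp {r} y

    -- The syndromes of the halves move by `γ a` and `γ (τ a)`, where `a` is the syndrome of `x`,
    -- and `τ-▷` relates the two.
    act-matched : ∀ {x x′ y y′} → Matched x x′ → Matched y y′ → Matched (act x y) (act x′ y′)
    act-matched {x} {x′} {y} {y′} (matched p p′ e) (matched q q′ f) =
      matched (trans (parity-act x y p) q) (trans (parity-act x′ y′ p′) q′) (begin
        τ (∑supp {r} (act x y))                      ≡⟨ cong τ (∑supp-act x y q) ⟩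
        τ (γ (∑supp {r} x) ▷ ∑supp {r} y)            ≡⟨ τ-▷ (∑supp {r} x) (∑supp {r} y) ⟩
        γ (τ (∑supp {r} x)) ▷ τ (∑supp {r} y)        ≡⟨ cong₂ (λ a b → γ a ▷ b) e f ⟩
        γ (∑supp {r} x′) ▷ ∑supp {r} y′              ≡⟨ ∑supp-act x′ y′ q′ ⟨
        ∑supp {r} (act x′ y′)                        ∎)
      where open ≡-Reasoning

    act-reflects : ∀ {x x′ y y′} → Matched x x′ → Matched (act x y) (act x′ y′) → Matched y y′
    act-reflects {x} {x′} {y} {y′} (matched p p′ e) (matched q q′ f) =
      -- The syndromes are compared after applying the injective map given by the syndrome of `x′`.
      matched even even′ (▷-injective (γ (∑supp {r} x′)) (begin
        γ (∑supp {r} x′) ▷ τ (∑supp {r} y)           ≡⟨ cong (λ a → γ a ▷ τ (∑supp {r} y)) e ⟨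
        γ (τ (∑supp {r} x)) ▷ τ (∑supp {r} y)        ≡⟨ τ-▷ (∑supp {r} x) (∑supp {r} y) ⟨
        τ (γ (∑supp {r} x) ▷ ∑supp {r} y)            ≡⟨ cong τ (∑supp-act x y even) ⟨
        τ (∑supp {r} (act x y))                      ≡⟨ f ⟩
        ∑supp {r} (act x′ y′)                        ≡⟨ ∑supp-act x′ y′ even′ ⟩
        γ (∑supp {r} x′) ▷ ∑supp {r} y′              ∎))
      where
      open ≡-Reasoning
      even : parity y ≡ false
      even = trans (sym (parity-act x y p)) q
      even′ : parity y′ ≡ false
      even′ = trans (sym (parity-act x′ y′ p′)) q′

    Π : F (N + N) → Permutation′ (N + N)
    Π z = π (left z) ⊕ₚ π (right z)

    open AutF (N + N) using () renaming (_▷_ to _▷′_)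

    left-▷ : ∀ z w → left ((z , Π z) ▷′ w) ≡ act (left z) (left w)
    left-▷ z w = trans (take-zipWith {m = N} _xor_ z (permute (Π z) w))
      (cong (left z ⊕_) (take-permute (π (left z)) (π (right z)) w))

    right-▷ : ∀ z w → right ((z , Π z) ▷′ w) ≡ act (right z) (right w)
    right-▷ z w = trans (drop-zipWith {m = N} _xor_ z (permute (Π z) w))
      (cong (right z ⊕_) (drop-permute (π (left z)) (π (right z)) w))

    union-propelinear : IsPropelinear Union
    union-propelinear = isPropelinear union? 𝟎∈ Π
      (λ {z} {w} z∈ w∈ → Matched⇒Union ((z , Π z) ▷′ w)
        (subst₂ Matched (sym (left-▷ z w)) (sym (right-▷ z w))
          (act-matched (Union⇒Matched z∈) (Union⇒Matched w∈))))
      (λ {z} z∈ w zw∈ → Matched⇒Union w (act-reflects (Union⇒Matched z∈)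
        (subst₂ Matched (left-▷ z w) (right-▷ z w) (Union⇒Matched zw∈))))
      λ {z} {w} z∈ w∈ i → let M = Union⇒Matched w∈ in
        -- The homomorphism rule holds on each half by `π-act`, and `⊕ₚ-∘ₚ` joins the halves.
        trans (cong₂ (λ x y → (π x ⊕ₚ π y) ⟨$⟩ʳ i) (left-▷ z w) (right-▷ z w))
        (trans (⊕ₚ-cong {π = π (act (left z) (left w))} {π (left w) ∘ₚ π (left z)}
                        {π (act (right z) (right w))} {π (right w) ∘ₚ π (right z)}
                 (π-act (left z) (left w) (even₁ M)) (π-act (right z) (right w) (even₂ M)) i)
               (⊕ₚ-∘ₚ (π (left w)) (π (left z)) (π (right w)) (π (right z)) i))
      where
      𝟎∈ : 𝟎 ∈ Union
      𝟎∈ = subst Union (++-𝟎 N) (Matched⇒Union (𝟎 {N} ++ 𝟎 {N})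
        (subst₂ Matched (sym (take-++ (𝟎 {N}) (𝟎 {N}))) (sym (drop-++ (𝟎 {N}) (𝟎 {N})))
          (matched (parity-𝟎 N) (parity-𝟎 N)
            (trans (cong τ ∑supp-𝟎) (trans τ-𝟎 (sym ∑supp-𝟎))))))

    -- Single flips and extended perfectness of the union.

    flip-left : ∀ z i → z ⊕ unit (i ↑ˡ N) ≡ (left z ⊕ unit i) ++ right z
    flip-left z i = trans (sym (take++drop≡id N _)) (cong₂ _++_
      (trans (take-zipWith {m = N} _xor_ z _)
        (cong (left z ⊕_) (trans (cong left (unit-↑ˡ i)) (take-++ (unit i) 𝟎))))
      (trans (drop-zipWith {m = N} _xor_ z _)
        (trans (cong (right z ⊕_) (trans (cong right (unit-↑ˡ i)) (drop-++ (unit i) 𝟎)))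
               (⊕-identityʳ (right z)))))

    flip-right : ∀ z i → z ⊕ unit (N ↑ʳ i) ≡ left z ++ (right z ⊕ unit i)
    flip-right z i = trans (sym (take++drop≡id N _)) (cong₂ _++_
      (trans (take-zipWith {m = N} _xor_ z _)
        (trans (cong (left z ⊕_) (trans (cong left (unit-↑ʳ N i)) (take-++ 𝟎 (unit i))))
               (⊕-identityʳ (left z))))
      (trans (drop-zipWith {m = N} _xor_ z _)
        (cong (right z ⊕_) (trans (cong right (unit-↑ʳ N i)) (drop-++ (𝟎 {N}) (unit i))))))

    ++-Union⇒Matched : ∀ x y → x ++ y ∈ Union → Matched x y
    ++-Union⇒Matched x y z∈ = subst₂ Matched (take-++ x y) (drop-++ x y) (Union⇒Matched z∈)

    Matched⇒++-Union : ∀ x y → Matched x y → x ++ y ∈ Union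
    Matched⇒++-Union x y M =
      Matched⇒Union (x ++ y) (subst₂ Matched (sym (take-++ x y)) (sym (drop-++ x y)) M)

    ∑supp-flip : ∀ x i → ∑supp {r} (x ⊕ unit i) ≡ ∑supp {r} x ⊕ vec i
    ∑supp-flip x i = trans (∑supp-⊕ x (unit i)) (cong (∑supp {r} x ⊕_) (∑supp-unit i))

    -- Every vector of F^r indexes a coordinate, so one flip reaches any prescribed syndrome `a`: at
    -- the coordinate indexed by the difference from the present one.
    flip-index : ∀ x a → ∑supp {r} (x ⊕ unit (index (∑supp {r} x ⊕ a))) ≡ a
    flip-index x a = trans (∑supp-flip x _)
      (trans (cong (∑supp {r} x ⊕_) (vec-index _)) (⊕-cancelˡ (∑supp {r} x) a))

    flip-injective : ∀ x {i j} → ∑supp {r} (x ⊕ unit i) ≡ ∑supp {r} (x ⊕ unit j) → i ≡ j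
    flip-injective x {i} {j} e = trans (sym (index-vec i)) (trans
      (cong index (⊕-injectiveʳ (∑supp {r} x) (trans (sym (∑supp-flip x i)) (trans e (∑supp-flip x j)))))
      (index-vec j))

    union-extendedPerfect : IsExtendedPerfect Union
    -- The first argument certifies that the length is positive; any coordinate would do.
    union-extendedPerfect = isExtendedPerfect (index 𝟎 ↑ˡ N) even correct unique
      where
      even : ∀ {z} → z ∈ Union → parity z ≡ false
      even {z} z∈ = trans (cong parity (sym (take++drop≡id N z)))
        (trans (parity-++ (left z) (right z)) (cong₂ _xor_ (even₁ M) (even₂ M)))
        where M = Union⇒Matched z∈

      correct : ∀ z → parity z ≡ true → ∃ λ i → z ⊕ unit i ∈ Union
      -- The last equation excludes halves of equal parity, so exactly one half is odd and has to be
      -- flipped.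
      correct z odd with parity (left z) in p | parity (right z) in q
                       | trans (sym (parity-++ (left z) (right z)))
                               (trans (cong parity (take++drop≡id N z)) odd)
      ... | true | false | _ = i ↑ˡ N , subst Union (sym (flip-left z i))
        (Matched⇒++-Union (left z ⊕ unit i) (right z)
          (matched (trans (parity-⊕-unit (left z) i) (cong not p)) q
            (trans (cong τ (flip-index (left z) (proj₁ hit))) (proj₂ hit))))
        where
        -- The left syndrome must become the preimage under `τ` of the right one.
        hit = τ-surjective (∑supp {r} (right z))
        i = index (∑supp {r} (left z) ⊕ proj₁ hit)
      ... | false | true | _ = N ↑ʳ i , subst Union (sym (flip-right z i))
        (Matched⇒++-Union (left z) (right z ⊕ unit i)
          (matched p (trans (parity-⊕-unit (right z) i) (cong not q))
            (sym (flip-index (right z) _))))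
        where
        -- The right syndrome must become the image under `τ` of the left one.
        i = index (∑supp {r} (right z) ⊕ τ (∑supp {r} (left z)))

      flippedˡ : ∀ z i → z ⊕ unit (i ↑ˡ N) ∈ Union → Matched (left z ⊕ unit i) (right z)
      flippedˡ z i z∈ = ++-Union⇒Matched _ _ (subst Union (flip-left z i) z∈)

      flippedʳ : ∀ z i → z ⊕ unit (N ↑ʳ i) ∈ Union → Matched (left z) (right z ⊕ unit i)
      flippedʳ z i z∈ = ++-Union⇒Matched _ _ (subst Union (flip-right z i) z∈)

      -- The left half cannot be even both before and after a flip.
      incompatible : ∀ {x y} i j → Matched (x ⊕ unit i) y → ¬ Matched x (y ⊕ unit j)
      incompatible {x} i j M M′ with trans (sym (even₁ M))
                                      (trans (parity-⊕-unit x i) (cong not (even₁ M′)))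
      ... | ()

      unique : ∀ z {i j} → z ⊕ unit i ∈ Union → z ⊕ unit j ∈ Union → i ≡ j
      unique z {i} {j} i∈ j∈ with ↑ˡ-or-↑ʳ N i | ↑ˡ-or-↑ʳ N j
      -- Two flips on the left give syndromes with the same image under `τ`, so its injectivity is
      -- needed; on the right the syndromes agree outright.
      ... | inj₁ (i , refl) | inj₁ (j , refl) = cong (_↑ˡ N) (flip-injective (left z)
        (τ-injective (trans (τ-∑ (flippedˡ z i i∈)) (sym (τ-∑ (flippedˡ z j j∈))))))
      ... | inj₂ (i , refl) | inj₂ (j , refl) = cong (N ↑ʳ_) (flip-injective (right z)
        (trans (sym (τ-∑ (flippedʳ z i i∈))) (τ-∑ (flippedʳ z j j∈))))
      ... | inj₁ (i , refl) | inj₂ (j , refl) =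
        contradiction (flippedʳ z j j∈) (incompatible i j (flippedˡ z i i∈))
      ... | inj₂ (i , refl) | inj₁ (j , refl) =
        contradiction (flippedʳ z i i∈) (incompatible j i (flippedˡ z j j∈))

theorem1 : (r : ℕ) → 1 ≤ r →
    (G : Subgroup (GA r) 0ℓ) (regular : IsRegularSubgroup G) →
    let open RegularSubgroup G regular in
    (T : Carrier → Carrier) → IsAutomorphism T →
    (τ : F r → F r) → Induces T τ →
    IsPropelinear (S τ) × IsExtendedPerfect (S τ)
theorem1 r _ G regular T iso τ induces =
  cast-length (cong (2 ^ r +_) (sym (+-identityʳ (2 ^ r)))) (union-propelinear , union-extendedPerfect)
  where
  open InducedPermutation G regular iso induces

  -- Stated for an equation between variable lengths, so that it can be matched with `refl`.
  cast-length : ∀ {m n} (e : m ≡ n) {C : Code m} → IsPropelinear C × IsExtendedPerfect C →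
                IsPropelinear (subst Code e C) × IsExtendedPerfect (subst Code e C)
  cast-length refl p = p
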